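{- There is a constant $C$ such that every locally Gabriel graph on a convexly independent set of $n\ge2$ points in the plane has at most $2n\log_2 n + Cn$ edges.
   Context: A finite point set $P\subset\mathbb{R}^2$ is convexly independent if no point of $P$ lies in the convex hull of the other points. A geometric graph $G=(P,E)$ is a locally Gabriel graph (LGG) if for every edge $\{u,v\}\in E$, the closed disk having the segment $\overline{uv}$ as diameter contains no neighbor (in $G$) of $u$ or of $v$ other than $u,v$ themselves; equivalently, two edges $\{u,v\},\{u,w\}\in E$ sharing the endpoint $u$ can coexist only if $\angle uwv<\pi/2$ and $\angle uvw<\pi/2$. -}

module Defs where

open import Level using (0ℓ)
open import Data.Nat as ℕ using (ℕ; zero; suc; z≤n; s≤s; _⊔_)
import Data.Nat.Properties as ℕ
open import Data.Nat.Induction using (<-rec)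
open import Data.Nat.Logarithm using (⌊log₂_⌋; ⌊log₂⌋-mono-≤; ⌊log₂⌊n/2⌋⌋≡⌊log₂n⌋∸1; ⌊log₂[2^n]⌋≡n)
import Data.Integer as ℤ
import Data.Integer.Properties as ℤ
open import Data.Rational using (ℚ; mkℚ; 0ℚ; 1ℚ; ½; _+_; _*_; _-_; -_; 1/_; _/_; ∣_∣; _<_; _≤_; toℚᵘ; Positive; positive; nonNegative; *<*)
open import Data.Rational.Properties
open import Data.Rational.Solver using (module +-*-Solver)
import Data.Rational.Unnormalised as ℚᵘ
import Data.Rational.Unnormalised.Properties as ℚᵘ
open import Data.Fin using (Fin)
import Data.Fin as Fin
open import Data.List using (List; length; filter; cartesianProduct; allFin)
import Data.Vec.Functional as Vector
open import Data.Product using (Σ; ∃; _×_; _,_; proj₁; proj₂)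
open import Data.Sum using (_⊎_; inj₁; inj₂)
open import Function.Definitions using (Injective)
open import Relation.Binary using (Rel; Symmetric; Irreflexive; Decidable)
open import Relation.Binary.PropositionalEquality using (_≡_; _≢_; refl; sym; trans; cong; cong₂; subst; subst₂)
open import Relation.Nullary using (¬_; _×-dec_)
open import Relation.Unary using (Pred)

-- Real numbers: Cauchy sequences of rationals, with setoid equality _≈_.

IsCauchy : (ℕ → ℚ) → Set
IsCauchy s = ∀ ε → 0ℚ < ε →
  ∃ λ N → ∀ m n → N ℕ.≤ m → N ℕ.≤ n → ∣ s m - s n ∣ < ε

record ℝ : Set where
  constructor mkℝ
  field
    seq    : ℕ → ℚ
    cauchy : IsCauchy seq

open ℝ public

infix  4 _≈_ _<ℝ_ _≤ℝ_
infixl 6 _+ℝ_ _-ℝ_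
infixl 7 _*ℝ_
infix  8 -ℝ_

_≈_ : ℝ → ℝ → Set
x ≈ y = ∀ ε → 0ℚ < ε → ∃ λ N → ∀ n → N ℕ.≤ n → ∣ seq x n - seq y n ∣ < ε

_<ℝ_ : ℝ → ℝ → Set
x <ℝ y = ∃ λ ε → 0ℚ < ε × ∃ λ N → ∀ n → N ℕ.≤ n → seq x n + ε < seq y n

_≤ℝ_ : ℝ → ℝ → Set
x ≤ℝ y = ¬ (y <ℝ x)

ε/2+ε/2 : ∀ ε → ε * ½ + ε * ½ ≡ ε
ε/2+ε/2 ε = trans (sym (*-distribˡ-+ ε ½ ½)) (*-identityʳ ε)

half-pos : ∀ {ε} → 0ℚ < ε → 0ℚ < ε * ½
half-pos {ε} 0<ε = positive⁻¹ (ε * ½) {{pos*pos⇒pos ε {{positive 0<ε}} ½}}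

fromℚ : ℚ → ℝ
fromℚ q = mkℝ (λ _ → q) λ ε 0<ε → 0 , λ _ _ _ _ →
  subst (λ z → ∣ z ∣ < ε) (sym (+-inverseʳ q)) 0<ε

fromℕ : ℕ → ℝ
fromℕ n = fromℚ (ℤ.+ n / 1)

0ℝ 1ℝ ½ℝ : ℝ
0ℝ = fromℚ 0ℚ
1ℝ = fromℚ 1ℚ
½ℝ = fromℚ ½

+-cauchy : ∀ s t → IsCauchy s → IsCauchy t → IsCauchy (λ n → s n + t n)
+-cauchy s t cs ct ε 0<ε with cs (ε * ½) (half-pos 0<ε) | ct (ε * ½) (half-pos 0<ε)
... | M , p | N , q = M ⊔ N , λ m n h k →
  subst₂ _<_ (cong ∣_∣ (sym (eq (s m) (s n) (t m) (t n)))) (ε/2+ε/2 ε)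
    (≤-<-trans (∣p+q∣≤∣p∣+∣q∣ (s m - s n) (t m - t n))
      (+-mono-< (p m n (ℕ.m⊔n≤o⇒m≤o M N h) (ℕ.m⊔n≤o⇒m≤o M N k))
                (q m n (ℕ.m⊔n≤o⇒n≤o M N h) (ℕ.m⊔n≤o⇒n≤o M N k))))
  where
  eq : ∀ a b c d → (a + c) - (b + d) ≡ (a - b) + (c - d)
  eq = solve 4 (λ a b c d → (a :+ c) :- (b :+ d) := (a :- b) :+ (c :- d)) refl
    where open +-*-Solver

neg-cauchy : ∀ s → IsCauchy s → IsCauchy (λ n → - s n)
neg-cauchy s cs ε 0<ε with cs ε 0<ε
... | N , p = N , λ m n h k →
  subst (_< ε) (trans (sym (∣-p∣≡∣p∣ (s m - s n))) (cong ∣_∣ (neg-distrib-+ (s m) (- s n)))) (p m n h k)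

EventuallyBounded : (ℕ → ℚ) → Set
EventuallyBounded s = ∃ λ B → 0ℚ < B × ∃ λ N → ∀ n → N ℕ.≤ n → ∣ s n ∣ ≤ B

cauchy⇒bounded : ∀ s → IsCauchy s → EventuallyBounded s
cauchy⇒bounded s cs with cs 1ℚ (positive⁻¹ 1ℚ)
... | N , p = 1ℚ + ∣ s N ∣ , +-mono-<-≤ (positive⁻¹ 1ℚ) (0≤∣p∣ (s N)) , N , λ n h →
  subst (λ z → ∣ z ∣ ≤ 1ℚ + ∣ s N ∣) (eq (s n) (s N))
    (≤-trans (∣p+q∣≤∣p∣+∣q∣ (s n - s N) (s N))
             (+-monoˡ-≤ ∣ s N ∣ (<⇒≤ (p n N h ℕ.≤-refl))))
  where
  eq : ∀ a b → (a - b) + b ≡ a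
  eq = solve 2 (λ a b → (a :- b) :+ b := a) refl
    where open +-*-Solver

scale : ∀ {B ε} → 0ℚ < B → 0ℚ < ε → ∃ λ δ → 0ℚ < δ × B * δ ≡ ε
scale {B} {ε} 0<B 0<ε = 1/B * ε , positive⁻¹ _ {{pos*pos⇒pos 1/B ε}} ,
  trans (sym (*-assoc B 1/B ε)) (trans (cong (_* ε) (*-inverseʳ B)) (*-identityˡ ε))
  where
  instance
    posB = positive 0<B
    posε = positive 0<ε
    nzB  = pos⇒nonZero B
  1/B = 1/ B
  instance
    pos1/B : Positive 1/B
    pos1/B = 1/pos⇒pos B

product-difference : ∀ a b c d → a * c - b * d ≡ a * (c - d) + d * (a - b)
product-difference = solve 4 (λ a b c d → a :* c :- b :* d := a :* (c :- d) :+ d :* (a :- b)) refl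
  where open +-*-Solver

∣u*v∣<Cγ : ∀ {C γ} → 0ℚ < C → ∀ u v → ∣ u ∣ ≤ C → ∣ v ∣ < γ → ∣ u * v ∣ < C * γ
∣u*v∣<Cγ {C} {γ} 0<C u v u≤C v<γ = subst (_< C * γ) (sym (∣p*q∣≡∣p∣*∣q∣ u v))
  (≤-<-trans (*-monoʳ-≤-nonNeg ∣ v ∣ {{nonNegative (0≤∣p∣ v)}} u≤C)
             (*-monoʳ-<-pos C {{positive 0<C}} v<γ))

*-cauchy : ∀ s t → IsCauchy s → IsCauchy t → IsCauchy (λ n → s n * t n)
*-cauchy s t cs ct ε 0<ε =
  let (A , 0<A , K , sb) = cauchy⇒bounded s cs
      (B , 0<B , L , tb) = cauchy⇒bounded t ct
      (α , 0<α , Aα)     = scale 0<A (half-pos 0<ε)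
      (β , 0<β , Bβ)     = scale 0<B (half-pos 0<ε)
      (M , p)            = ct α 0<α
      (N , q)            = cs β 0<β
  in (K ⊔ L) ⊔ (M ⊔ N) , λ m n h k →
    let hKL = ℕ.m⊔n≤o⇒m≤o (K ⊔ L) (M ⊔ N) h
        hMN = ℕ.m⊔n≤o⇒n≤o (K ⊔ L) (M ⊔ N) h
        kKL = ℕ.m⊔n≤o⇒m≤o (K ⊔ L) (M ⊔ N) k
        kMN = ℕ.m⊔n≤o⇒n≤o (K ⊔ L) (M ⊔ N) k
    in subst₂ _<_ (cong ∣_∣ (sym (product-difference (s m) (s n) (t m) (t n))))
                  (trans (cong₂ _+_ Aα Bβ) (ε/2+ε/2 ε))
      (≤-<-trans (∣p+q∣≤∣p∣+∣q∣ (s m * (t m - t n)) (t n * (s m - s n)))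
        (+-mono-<
          (∣u*v∣<Cγ 0<A (s m) (t m - t n) (sb m (ℕ.m⊔n≤o⇒m≤o K L hKL))
            (p m n (ℕ.m⊔n≤o⇒m≤o M N hMN) (ℕ.m⊔n≤o⇒m≤o M N kMN)))
          (∣u*v∣<Cγ 0<B (t n) (s m - s n) (tb n (ℕ.m⊔n≤o⇒n≤o K L kKL))
            (q m n (ℕ.m⊔n≤o⇒n≤o M N hMN) (ℕ.m⊔n≤o⇒n≤o M N kMN)))))

_+ℝ_ : ℝ → ℝ → ℝ
x +ℝ y = mkℝ (λ n → seq x n + seq y n) (+-cauchy (seq x) (seq y) (cauchy x) (cauchy y))

_*ℝ_ : ℝ → ℝ → ℝ
x *ℝ y = mkℝ (λ n → seq x n * seq y n) (*-cauchy (seq x) (seq y) (cauchy x) (cauchy y))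

-ℝ_ : ℝ → ℝ
-ℝ x = mkℝ (λ n → - seq x n) (neg-cauchy (seq x) (cauchy x))

_-ℝ_ : ℝ → ℝ → ℝ
x -ℝ y = x +ℝ (-ℝ y)

sumℝ : ∀ {m} → (Fin m → ℝ) → ℝ
sumℝ = Vector.foldr _+ℝ_ 0ℝ

-- The real number log₂ n.  If a = ⌊log₂ (n ^ p)⌋ then 2 ^ a ≤ n ^ p < 2 ^ (1 + a),
-- so a / p is within 1 / p of log₂ n; the p-th term of the sequence uses
-- p + 1 in place of p.  The value at n = 0 is the junk value 0.

frac : ℕ → ℕ → ℚ
frac a p = ℤ.+ a / suc p

log₂-seq : ℕ → ℕ → ℚ
log₂-seq n p = frac ⌊log₂ (n ℕ.^ suc p) ⌋ p

toℚᵘ-frac : ∀ a p → toℚᵘ (frac a p) ℚᵘ.≃ ℚᵘ.mkℚᵘ (ℤ.+ a) p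
toℚᵘ-frac a p = toℚᵘ-fromℚᵘ (ℚᵘ.mkℚᵘ (ℤ.+ a) p)

frac-< : ∀ a p b q → a ℕ.* suc q ℕ.< b ℕ.* suc p → frac a p < frac b q
frac-< a p b q h = toℚᵘ-cancel-<
  (ℚᵘ.<-respˡ-≃ (ℚᵘ.≃-sym (toℚᵘ-frac a p)) (ℚᵘ.<-respʳ-≃ (ℚᵘ.≃-sym (toℚᵘ-frac b q))
    (ℚᵘ.*<* (subst₂ ℤ._<_ (ℤ.pos-* a (suc q)) (ℤ.pos-* b (suc p)) (ℤ.+<+ h)))))

frac-suc : ∀ b q → frac (suc b) q ≡ frac b q + frac 1 q
frac-suc b q = toℚᵘ-injective (ℚᵘ.≃-trans (toℚᵘ-frac (suc b) q) (ℚᵘ.≃-sym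
  (ℚᵘ.≃-trans (toℚᵘ-homo-+ (frac b q) (frac 1 q))
    (ℚᵘ.≃-trans (ℚᵘ.+-cong (toℚᵘ-frac b q) (toℚᵘ-frac 1 q)) (ℚᵘ.*≡* eq)))))
  where
  d = suc q
  natEq : (b ℕ.* d ℕ.+ 1 ℕ.* d) ℕ.* d ≡ suc b ℕ.* (d ℕ.* d)
  natEq = trans (cong (ℕ._* d) (trans (sym (ℕ.*-distribʳ-+ d b 1)) (cong (ℕ._* d) (ℕ.+-comm b 1))))
                (ℕ.*-assoc (suc b) d d)
  eq : (ℤ.+ b ℤ.* ℤ.+ d ℤ.+ ℤ.+ 1 ℤ.* ℤ.+ d) ℤ.* ℤ.+ d ≡ ℤ.+ suc b ℤ.* (ℤ.+ (d ℕ.* d))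
  eq = trans (cong (ℤ._* ℤ.+ d) (cong₂ ℤ._+_ (sym (ℤ.pos-* b d)) (sym (ℤ.pos-* 1 d))))
       (trans (sym (ℤ.pos-* (b ℕ.* d ℕ.+ 1 ℕ.* d) d))
       (trans (cong ℤ.+_ natEq) (ℤ.pos-* (suc b) (d ℕ.* d))))

archimedean : ∀ ε → 0ℚ < ε → ∃ λ N → ∀ q → N ℕ.≤ q → frac 1 q < ε
archimedean ε@(mkℚ (ℤ.+ suc a) d _) 0<ε = suc d , λ q h → toℚᵘ-cancel-<
  (ℚᵘ.<-respˡ-≃ (ℚᵘ.≃-sym (toℚᵘ-frac 1 q))
    (ℚᵘ.*<* (subst₂ ℤ._<_ (ℤ.pos-* 1 (suc d)) (ℤ.pos-* (suc a) (suc q))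
      (ℤ.+<+ (ℕ.<-≤-trans (subst (ℕ._< suc q) (sym (ℕ.*-identityˡ (suc d))) (s≤s h))
                          (ℕ.m≤n*m (suc q) (suc a)))))))
archimedean (mkℚ (ℤ.+ zero) _ _) (*<* (ℤ.+<+ ()))
archimedean (mkℚ (ℤ.-[1+ _ ]) _ _) (*<* ())

n<2^[1+⌊log₂n⌋] : ∀ n → n ℕ.< 2 ℕ.^ suc ⌊log₂ n ⌋
n<2^[1+⌊log₂n⌋] n = ℕ.≰⇒> λ h → ℕ.1+n≰n
  (subst (ℕ._≤ ⌊log₂ n ⌋) (⌊log₂[2^n]⌋≡n (suc ⌊log₂ n ⌋)) (⌊log₂⌋-mono-≤ h))

2*⌊n/2⌋≤n : ∀ n → 2 ℕ.* ℕ.⌊ n /2⌋ ℕ.≤ n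
2*⌊n/2⌋≤n n = subst (2 ℕ.* ℕ.⌊ n /2⌋ ℕ.≤_) (ℕ.⌊n/2⌋+⌈n/2⌉≡n n)
  (ℕ.+-monoʳ-≤ ℕ.⌊ n /2⌋ (subst (ℕ._≤ ℕ.⌈ n /2⌉) (sym (ℕ.+-identityʳ _)) (ℕ.⌊n/2⌋≤⌈n/2⌉ n)))

2^⌊log₂n⌋≤n : ∀ n → 1 ℕ.≤ n → 2 ℕ.^ ⌊log₂ n ⌋ ℕ.≤ n
2^⌊log₂n⌋≤n = <-rec _ step
  where
  step : ∀ n → (∀ {m} → m ℕ.< n → 1 ℕ.≤ m → 2 ℕ.^ ⌊log₂ m ⌋ ℕ.≤ m) →
         1 ℕ.≤ n → 2 ℕ.^ ⌊log₂ n ⌋ ℕ.≤ n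
  step 1 _ _ = s≤s z≤n
  step n@(suc (suc k)) rec _ = ℕ.≤-trans
    (ℕ.^-monoʳ-≤ 2 (ℕ.m≤n+m∸n ⌊log₂ n ⌋ 1))
    (ℕ.≤-trans
      (ℕ.*-monoʳ-≤ 2 (subst (λ e → 2 ℕ.^ e ℕ.≤ ℕ.⌊ n /2⌋) (⌊log₂⌊n/2⌋⌋≡⌊log₂n⌋∸1 n)
        (rec (ℕ.⌊n/2⌋<n (suc k)) (s≤s z≤n))))
      (2*⌊n/2⌋≤n n))

log₂-cross : ∀ n → 1 ℕ.≤ n → ∀ p q →
  ⌊log₂ (n ℕ.^ suc p) ⌋ ℕ.* suc q ℕ.< suc ⌊log₂ (n ℕ.^ suc q) ⌋ ℕ.* suc p
log₂-cross n@(suc _) _ p q = ℕ.≰⇒> λ h → ℕ.<⇒≱ lt (ℕ.^-monoʳ-≤ 2 h)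
  where
  open ℕ.≤-Reasoning
  a = ⌊log₂ (n ℕ.^ suc p) ⌋
  b = ⌊log₂ (n ℕ.^ suc q) ⌋
  lt : 2 ℕ.^ (a ℕ.* suc q) ℕ.< 2 ℕ.^ (suc b ℕ.* suc p)
  lt = begin-strict
    2 ℕ.^ (a ℕ.* suc q)         ≡⟨ sym (ℕ.^-*-assoc 2 a (suc q)) ⟩
    (2 ℕ.^ a) ℕ.^ suc q         ≤⟨ ℕ.^-monoˡ-≤ (suc q) (2^⌊log₂n⌋≤n (n ℕ.^ suc p) (ℕ.m^n>0 n (suc p))) ⟩
    (n ℕ.^ suc p) ℕ.^ suc q     ≡⟨ ℕ.^-*-assoc n (suc p) (suc q) ⟩
    n ℕ.^ (suc p ℕ.* suc q)     ≡⟨ cong (n ℕ.^_) (ℕ.*-comm (suc p) (suc q)) ⟩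
    n ℕ.^ (suc q ℕ.* suc p)     ≡⟨ sym (ℕ.^-*-assoc n (suc q) (suc p)) ⟩
    (n ℕ.^ suc q) ℕ.^ suc p     <⟨ ℕ.^-monoˡ-< (suc p) (n<2^[1+⌊log₂n⌋] (n ℕ.^ suc q)) ⟩
    (2 ℕ.^ suc b) ℕ.^ suc p     ≡⟨ ℕ.^-*-assoc 2 (suc b) (suc p) ⟩
    2 ℕ.^ (suc b ℕ.* suc p)     ∎

∣x-y∣<ε : ∀ {x y ε} → x < y + ε → y < x + ε → ∣ x - y ∣ < ε
∣x-y∣<ε {x} {y} {ε} p q with ∣p∣≡p∨∣p∣≡-p (x - y)
... | inj₁ e = subst₂ _<_ (sym e) (eq y ε) (+-monoˡ-< (- y) p)
  where
  eq : ∀ y ε → (y + ε) - y ≡ ε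
  eq = solve 2 (λ y ε → (y :+ ε) :- y := ε) refl
    where open +-*-Solver
... | inj₂ e = subst₂ _<_ (trans (eq₁ x y) (sym e)) (eq₂ x ε) (+-monoˡ-< (- x) q)
  where
  open +-*-Solver
  eq₁ : ∀ x y → y - x ≡ - (x - y)
  eq₁ = solve 2 (λ x y → y :- x := :- (x :- y)) refl
  eq₂ : ∀ x ε → (x + ε) - x ≡ ε
  eq₂ = solve 2 (λ x ε → (x :+ ε) :- x := ε) refl

log₂-cauchy : ∀ n → 1 ℕ.≤ n → IsCauchy (log₂-seq n)
log₂-cauchy n 1≤n ε 0<ε with archimedean ε 0<ε
... | N , small = N , λ p q h k → ∣x-y∣<ε (close p q k) (close q p h)
  where
  close : ∀ p q → N ℕ.≤ q → log₂-seq n p < log₂-seq n q + ε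
  close p q k = <-trans
    (subst (log₂-seq n p <_) (frac-suc b q) (frac-< a p (suc b) q (log₂-cross n 1≤n p q)))
    (+-monoʳ-< (log₂-seq n q) (small q k))
    where
    a = ⌊log₂ (n ℕ.^ suc p) ⌋
    b = ⌊log₂ (n ℕ.^ suc q) ⌋

log₂ : ℕ → ℝ
log₂ zero      = 0ℝ
log₂ n@(suc _) = mkℝ (log₂-seq n) (log₂-cauchy n (s≤s z≤n))

Point : Set
Point = ℝ × ℝ

infix 4 _≈ₚ_

_≈ₚ_ : Point → Point → Set
(x , y) ≈ₚ (x′ , y′) = x ≈ x′ × y ≈ y′

midpoint : Point → Point → Point
midpoint (x , y) (x′ , y′) = ½ℝ *ℝ (x +ℝ x′) , ½ℝ *ℝ (y +ℝ y′)

dist² : Point → Point → ℝ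
dist² (x , y) (x′ , y′) = (x -ℝ x′) *ℝ (x -ℝ x′) +ℝ (y -ℝ y′) *ℝ (y -ℝ y′)

-- The closed disk with diameter uv: centre the midpoint of uv, radius the
-- distance from the centre to u; the two distances are compared by squares.
InClosedDisk : Point → Point → Pred Point 0ℓ
InClosedDisk u v w = dist² w (midpoint u v) ≤ℝ dist² u (midpoint u v)

ConvexHull : Pred Point 0ℓ → Pred Point 0ℓ
ConvexHull S x =
  ∃ λ m → Σ (Fin m → Point) λ q → Σ (Fin m → ℝ) λ c →
    (∀ k → S (q k)) ×
    (∀ k → 0ℝ ≤ℝ c k) ×
    sumℝ c ≈ 1ℝ ×
    (sumℝ (λ k → c k *ℝ proj₁ (q k)) , sumℝ (λ k → c k *ℝ proj₂ (q k))) ≈ₚ x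

Distinct : ∀ {n} → (Fin n → Point) → Set
Distinct P = Injective _≡_ _≈ₚ_ P

ConvexlyIndependent : ∀ {n} → (Fin n → Point) → Set
ConvexlyIndependent P =
  ∀ i → ¬ ConvexHull (λ x → ∃ λ j → j ≢ i × x ≈ₚ P j) (P i)

-- Geometric graphs: vertex i of the graph is placed at the point P i.

record Graph (n : ℕ) : Set₁ where
  infix 4 _~_ _~?_
  field
    _~_    : Rel (Fin n) 0ℓ
    _~?_   : Decidable _~_
    symm   : Symmetric _~_
    irrefl : Irreflexive _≡_ _~_

  -- i < j makes each unordered edge appear exactly once.
  edges : List (Fin n × Fin n)
  edges = filter (λ (i , j) → (i Fin.<? j) ×-dec (i ~? j))
                 (cartesianProduct (allFin n) (allFin n))

  edgeCount : ℕ
  edgeCount = length edges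

LocallyGabriel : ∀ {n} → (Fin n → Point) → Graph n → Set
LocallyGabriel P G =
  ∀ u v → u ~ v → ∀ w → w ≢ u → w ≢ v → u ~ w ⊎ v ~ w →
  ¬ InClosedDisk (P u) (P v) (P w)
  where open Graph G

{-# OPTIONS --safe #-}
module Submission where

-- Every point p of a convexly independent set lies on a line of some slope t p that supports the set
-- from above or from below.  Sort the points by t p and cut the sorted sequence into a lower and an
-- upper part.  Among the edges ab between the parts (a lower, b upper) with both ends supported on the
-- same side, no path b′ a b a′ can have t a′ < t a and t b < t b′: slopes of chords lie between the
-- slopes at their ends, and the acute angles at a and b would force the slope of ab to have both signs.
-- Likewise, for ends supported on opposite sides, no path can have t a < t a′ and t b′ < t b.  So each
-- edge is extremal at one of its ends, the two parts are joined by at most twice as many edges as there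
-- are points, and divide and conquer gives at most 2 n k edges whenever n ≤ 2 ^ k.
--
-- Only finitely many strict inequalities between polynomials in the coordinates matter, so, once their
-- signs are known (classically, which is harmless as the bound is decidable), the argument can be run on
-- rational approximations of the points.

open import Defs
open import Data.Bool using (Bool; true; false; not)
import Data.Bool.Properties as Bool
open import Data.Empty using (⊥; ⊥-elim)
open import Data.Fin using (Fin; zero; suc)
import Data.Fin as Fin
import Data.Fin.Properties as Fin
import Data.Integer as ℤ
import Data.Integer.Properties as ℤ
open import Data.List using (List; allFin; cartesianProduct; length)
import Data.List.Properties as List
open import Data.List.Membership.Propositional using (_∈_)
open import Data.List.Relation.Binary.Permutation.Propositional using (_↭_; ↭-sym; ↭⇒↭ₛ)
import Data.List.Relation.Binary.Permutation.Propositional.Properties as Perm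
import Data.List.Relation.Binary.Permutation.Setoid.Properties as PermSetoid
open import Data.List.Relation.Unary.AllPairs using (AllPairs)
import Data.List.Relation.Unary.AllPairs.Properties as AllPairs
import Data.List.Relation.Unary.Sorted.TotalOrder.Properties as Sorted
open import Data.List.Relation.Unary.Unique.Propositional using (Unique)
import Data.List.Sort as Sort
open import Data.Nat as ℕ using (ℕ; zero; suc; _⊔_; z≤n; s≤s)
open import Data.Nat.Logarithm using (⌊log₂_⌋; ⌊log₂⌋-mono-≤; ⌊log₂[2^n]⌋≡n)
import Data.Nat.Properties as ℕ
open import Data.Product using (∃; ∃₂; Σ; _×_; _,_; proj₁; proj₂)
open import Data.Sum using (_⊎_; inj₁; inj₂; [_,_]′)
open import Relation.Binary.Bundles using (DecTotalOrder)
import Relation.Binary.Construct.On as On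
open import Relation.Binary.Definitions using (tri<; tri≈; tri>)
open import Relation.Binary.PropositionalEquality using (_≡_; _≢_; refl; sym; trans; cong; cong₂; subst; subst₂; setoid)
open import Relation.Nullary using (¬_; Dec; yes; no; ¬?; _×-dec_; _→-dec_)
open import Relation.Nullary.Decidable using (decidable-stable; ¬¬-excluded-middle)

-- Finite sums, double counting and divide and conquer over lists.

module Counting where
  open import Data.List using ([]; _∷_; _++_; map; filter; take; drop)
  open import Data.List.Membership.Propositional.Properties using (∈-++⁺ʳ)
  open import Data.List.Relation.Unary.All as All using (All; []; _∷_)
  open import Data.List.Relation.Unary.AllPairs using ([]; _∷_)
  open import Data.List.Relation.Unary.Any using (here; there)
  open import Data.Nat using (_+_; _*_; _≤_; _^_)
  open import Data.Nat.ListAction using (sum)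
  open import Data.Nat.ListAction.Properties using (sum-↭; sum-++)
  open import Data.Nat.Solver using (module +-*-Solver)
  open +-*-Solver using (solve; _:+_; _:*_; _:=_; con)

  ⟦_⟧ : ∀ {p} {P : Set p} → Dec P → ℕ
  ⟦ yes _ ⟧ = 1
  ⟦ no  _ ⟧ = 0

  ⟦⟧-⊎ : {P Q R : Set} (p : Dec P) (q : Dec Q) (r : Dec R) → (P → Q ⊎ R) → ⟦ p ⟧ ≤ ⟦ q ⟧ + ⟦ r ⟧
  ⟦⟧-⊎ (no _)  _       _       _ = z≤n
  ⟦⟧-⊎ (yes x) (yes _) _       _ = s≤s z≤n
  ⟦⟧-⊎ (yes x) (no ¬y) (yes _) _ = s≤s z≤n
  ⟦⟧-⊎ (yes x) (no ¬y) (no ¬z) f with f x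
  ... | inj₁ y = ⊥-elim (¬y y)
  ... | inj₂ z = ⊥-elim (¬z z)

  ∑ : {A : Set} → List A → (A → ℕ) → ℕ
  ∑ xs f = sum (map f xs)

  ∑-mono : {A : Set} (xs : List A) {f g : A → ℕ} → (∀ {x} → x ∈ xs → f x ≤ g x) → ∑ xs f ≤ ∑ xs g
  ∑-mono []       _ = z≤n
  ∑-mono (x ∷ xs) h = ℕ.+-mono-≤ (h (here refl)) (∑-mono xs (λ i → h (there i)))

  ∑-cong : {A : Set} (xs : List A) {f g : A → ℕ} → (∀ x → f x ≡ g x) → ∑ xs f ≡ ∑ xs g
  ∑-cong xs h = cong sum (List.map-cong h xs)

  ∑-≤1 : {A : Set} (xs : List A) {f : A → ℕ} → (∀ x → f x ≤ 1) → ∑ xs f ≤ length xs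
  ∑-≤1 []       _ = z≤n
  ∑-≤1 (x ∷ xs) h = ℕ.+-mono-≤ (h x) (∑-≤1 xs h)

  +-interchange : ∀ a b c d → (a + b) + (c + d) ≡ (a + c) + (b + d)
  +-interchange = solve 4 (λ a b c d → (a :+ b) :+ (c :+ d) := (a :+ c) :+ (b :+ d)) refl

  ∑-+ : {A : Set} (xs : List A) (f g : A → ℕ) → ∑ xs (λ x → f x + g x) ≡ ∑ xs f + ∑ xs g
  ∑-+ []       f g = refl
  ∑-+ (x ∷ xs) f g = trans (cong (f x + g x +_) (∑-+ xs f g)) (+-interchange (f x) (g x) (∑ xs f) (∑ xs g))

  ∑-++ : {A : Set} (xs ys : List A) (f : A → ℕ) → ∑ (xs ++ ys) f ≡ ∑ xs f + ∑ ys f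
  ∑-++ xs ys f = trans (cong sum (List.map-++ f xs ys)) (sum-++ (map f xs) (map f ys))

  ∑-swap : {A B : Set} (xs : List A) (ys : List B) (f : A → B → ℕ) →
    ∑ xs (λ x → ∑ ys (f x)) ≡ ∑ ys (λ y → ∑ xs (λ x → f x y))
  ∑-swap []       ys f = sym (zeros ys)
    where
    zeros : ∀ {B : Set} (ys : List B) → ∑ ys (λ _ → 0) ≡ 0
    zeros []       = refl
    zeros (_ ∷ ys) = zeros ys
  ∑-swap (x ∷ xs) ys f = trans (cong (∑ ys (f x) +_) (∑-swap xs ys f))
    (sym (∑-+ ys (f x) (λ y → ∑ xs (λ x → f x y))))

  ∑-↭ : {A : Set} {xs ys : List A} (f : A → ℕ) → xs ↭ ys → ∑ xs f ≡ ∑ ys f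
  ∑-↭ f p = sum-↭ (Perm.map⁺ f p)

  length-filter-∑ : {A : Set} {P : A → Set} (P? : ∀ x → Dec (P x)) (xs : List A) →
    length (filter P? xs) ≡ ∑ xs (λ x → ⟦ P? x ⟧)
  length-filter-∑ P? []       = refl
  length-filter-∑ P? (x ∷ xs) with P? x
  ... | yes _ = cong suc (length-filter-∑ P? xs)
  ... | no  _ = length-filter-∑ P? xs

  ∑-map : {A B : Set} (h : A → B) (xs : List A) (f : B → ℕ) → ∑ (map h xs) f ≡ ∑ xs (λ x → f (h x))
  ∑-map h xs f = cong sum (sym (List.map-∘ xs))

  ∑-cartesianProduct : {A B : Set} (xs : List A) (ys : List B) (f : A × B → ℕ) →
    ∑ (cartesianProduct xs ys) f ≡ ∑ xs (λ x → ∑ ys (λ y → f (x , y)))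
  ∑-cartesianProduct []       ys f = refl
  ∑-cartesianProduct (x ∷ xs) ys f = trans (∑-++ (map (x ,_) ys) (cartesianProduct xs ys) f)
    (cong₂ _+_ (∑-map (x ,_) ys f) (∑-cartesianProduct xs ys f))

  ∑-none : {A : Set} {P : A → Set} (P? : ∀ x → Dec (P x)) (xs : List A) →
    (∀ {x} → x ∈ xs → ¬ P x) → ∑ xs (λ x → ⟦ P? x ⟧) ≡ 0
  ∑-none P? []       _ = refl
  ∑-none P? (x ∷ xs) h with P? x
  ... | yes p = ⊥-elim (h (here refl) p)
  ... | no  _ = ∑-none P? xs (λ i → h (there i))

  -- An argument by contradiction delivers only `¬ x ≢ y`; `Unique` supplies the `x ≢ y` that
  -- refutes it for entries at different places.
  ∑-unique : {A : Set} {P : A → Set} (P? : ∀ x → Dec (P x)) {xs : List A} → Unique xs →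
    (∀ {x y} → x ∈ xs → y ∈ xs → P x → P y → ¬ x ≢ y) → ∑ xs (λ x → ⟦ P? x ⟧) ≤ 1
  ∑-unique P? []                     _ = z≤n
  ∑-unique P? (_∷_ {x} {xs} x∉xs uq) h with P? x
  ... | yes p = ℕ.≤-reflexive (cong suc (∑-none P? xs λ i q → h (here refl) (there i) p q (All.lookup x∉xs i)))
  ... | no  _ = ∑-unique P? uq (λ i j → h (there i) (there j))

  -- Every pair (a , b) in R is extremal (with respect to ≺₁ or ≺₂) at one of its two ends,
  -- and each element is the extremal end of at most one pair.
  module _ {A B : Set} {R : A → B → Set} (R? : ∀ a b → Dec (R a b))
           {_≺₁_ : A → A → Set} (_≺₁?_ : ∀ a a′ → Dec (a ≺₁ a′))
           {_≺₂_ : B → B → Set} (_≺₂?_ : ∀ b b′ → Dec (b ≺₂ b′)) where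

    ∑-bipartite : ∀ {xs ys} → Unique xs → Unique ys →
      (∀ {a a′ b} → R a b → R a′ b → a ≢ a′ → a ≺₁ a′ ⊎ a′ ≺₁ a) →
      (∀ {a b b′} → R a b → R a b′ → b ≢ b′ → b ≺₂ b′ ⊎ b′ ≺₂ b) →
      (∀ {a a′ b b′} → a ∈ xs → a′ ∈ xs → b ∈ ys → b′ ∈ ys →
        R a b → R a′ b → R a b′ → a′ ≺₁ a → b′ ≺₂ b → ⊥) →
      ∑ xs (λ a → ∑ ys (λ b → ⟦ R? a b ⟧)) ≤ length xs + length ys
    ∑-bipartite {xs} {ys} uxs uys connex₁ connex₂ no-path = begin
      ∑ xs (λ a → ∑ ys (λ b → ⟦ R? a b ⟧))
        ≤⟨ ∑-mono xs (λ {a} i → ∑-mono ys (λ {b} j → ⟦⟧-⊎ (R? a b) (Q₂? a b) (Q₁? a b) (choose i j))) ⟩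
      ∑ xs (λ a → ∑ ys (λ b → ⟦ Q₂? a b ⟧ + ⟦ Q₁? a b ⟧))
        ≡⟨ ∑-cong xs (λ a → ∑-+ ys (λ b → ⟦ Q₂? a b ⟧) (λ b → ⟦ Q₁? a b ⟧)) ⟩
      ∑ xs (λ a → ∑ ys (λ b → ⟦ Q₂? a b ⟧) + ∑ ys (λ b → ⟦ Q₁? a b ⟧))
        ≡⟨ ∑-+ xs (λ a → ∑ ys (λ b → ⟦ Q₂? a b ⟧)) (λ a → ∑ ys (λ b → ⟦ Q₁? a b ⟧)) ⟩
      ∑ xs (λ a → ∑ ys (λ b → ⟦ Q₂? a b ⟧)) + ∑ xs (λ a → ∑ ys (λ b → ⟦ Q₁? a b ⟧))
        ≡⟨ cong (∑ xs (λ a → ∑ ys (λ b → ⟦ Q₂? a b ⟧)) +_) (∑-swap xs ys (λ a b → ⟦ Q₁? a b ⟧)) ⟩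
      ∑ xs (λ a → ∑ ys (λ b → ⟦ Q₂? a b ⟧)) + ∑ ys (λ b → ∑ xs (λ a → ⟦ Q₁? a b ⟧))
        ≤⟨ ℕ.+-mono-≤ (∑-≤1 xs (λ a → ∑-unique (Q₂? a) uys unique₂))
                      (∑-≤1 ys (λ b → ∑-unique (λ a → Q₁? a b) uxs unique₁)) ⟩
      length xs + length ys ∎
      where
      open ℕ.≤-Reasoning
      Q₁ : A → B → Set
      Q₁ a b = R a b × All (λ a′ → R a′ b → ¬ a′ ≺₁ a) xs
      Q₂ : A → B → Set
      Q₂ a b = R a b × All (λ b′ → R a b′ → ¬ b′ ≺₂ b) ys
      Q₁? : ∀ a b → Dec (Q₁ a b)
      Q₁? a b = R? a b ×-dec All.all? (λ a′ → R? a′ b →-dec ¬? (a′ ≺₁? a)) xs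
      Q₂? : ∀ a b → Dec (Q₂ a b)
      Q₂? a b = R? a b ×-dec All.all? (λ b′ → R? a b′ →-dec ¬? (b′ ≺₂? b)) ys
      unique₁ : ∀ {a a′ b} → a ∈ xs → a′ ∈ xs → Q₁ a b → Q₁ a′ b → ¬ a ≢ a′
      unique₁ i i′ (r , m) (r′ , m′) a≢a′ with connex₁ r r′ a≢a′
      ... | inj₁ a≺a′ = All.lookup m′ i r a≺a′
      ... | inj₂ a′≺a = All.lookup m i′ r′ a′≺a
      unique₂ : ∀ {a b b′} → b ∈ ys → b′ ∈ ys → Q₂ a b → Q₂ a b′ → ¬ b ≢ b′
      unique₂ j j′ (r , m) (r′ , m′) b≢b′ with connex₂ r r′ b≢b′
      ... | inj₁ b≺b′ = All.lookup m′ j r b≺b′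
      ... | inj₂ b′≺b = All.lookup m j′ r′ b′≺b
      choose : ∀ {a b} → a ∈ xs → b ∈ ys → R a b → Q₂ a b ⊎ Q₁ a b
      choose {a} {b} i j r with Q₂? a b
      ... | yes q = inj₁ q
      -- If `b` is not minimal among the neighbours of `a`, then `a` is minimal among those of `b`:
      -- a smaller neighbour `a′` of `b` would, by `no-path`, rule out every `b′` below `b`, which
      -- contradicts `¬q`.
      ... | no ¬q = inj₂ (r , All.tabulate λ i′ r′ a′≺a →
        ¬q (r , All.tabulate λ j′ s b′≺b → no-path i i′ j j′ r r′ s a′≺a b′≺b))

  AllPairs-++⁻ : {A : Set} {R : A → A → Set} (xs : List A) {ys : List A} → AllPairs R (xs ++ ys) →
    ∀ {x y} → x ∈ xs → y ∈ ys → R x y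
  AllPairs-++⁻ (x ∷ xs) (x∼ ∷ _)  (here refl) j = All.lookup x∼ (∈-++⁺ʳ xs j)
  AllPairs-++⁻ (x ∷ xs) (_ ∷ prs) (there i)   j = AllPairs-++⁻ xs prs i j

  -- Cutting the sorted list after `2 ^ k` entries splits the square of ordered pairs into two
  -- diagonal blocks, bounded by induction, and two off-diagonal blocks, which `linear` bounds
  -- together once one of them is transposed. Each level of the recursion costs at most twice the
  -- total length.
  ∑²-divide : {A : Set} {_⊑_ : A → A → Set} (g : A → A → ℕ) → (∀ x → g x x ≡ 0) →
    (∀ {xs ys} → Unique xs → Unique ys → (∀ {x y} → x ∈ xs → y ∈ ys → x ⊑ y) →
      (∀ {x y} → x ∈ xs → y ∈ ys → x ≢ y) →
      ∑ xs (λ x → ∑ ys (λ y → g x y + g y x)) ≤ 2 * (length xs + length ys)) →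
    ∀ k xs → AllPairs _⊑_ xs → Unique xs → length xs ≤ 2 ^ k →
    ∑ xs (λ x → ∑ xs (g x)) ≤ 2 * length xs * k
  ∑²-divide g diag linear zero []           _ _ _ = z≤n
  ∑²-divide g diag linear zero (x ∷ [])     _ _ _ = ℕ.≤-reflexive (cong (λ e → e + 0 + 0) (diag x))
  ∑²-divide g diag linear zero (x ∷ y ∷ xs) _ _ (s≤s ())
  ∑²-divide {_⊑_ = _⊑_} g diag linear (suc k) zs sorted uq len =
    subst (λ zs → ∑ zs (λ x → ∑ zs (g x)) ≤ 2 * length zs * suc k) (List.take++drop≡id (2 ^ k) zs) (begin
      ∑ (xs ++ ys) (λ x → ∑ (xs ++ ys) (g x))
        ≡⟨ ∑-cong (xs ++ ys) (λ x → ∑-++ xs ys (g x)) ⟩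
      ∑ (xs ++ ys) (λ x → ∑ xs (g x) + ∑ ys (g x))
        ≡⟨ ∑-++ xs ys (λ x → ∑ xs (g x) + ∑ ys (g x)) ⟩
      ∑ xs (λ x → ∑ xs (g x) + ∑ ys (g x)) + ∑ ys (λ y → ∑ xs (g y) + ∑ ys (g y))
        ≡⟨ cong₂ _+_ (∑-+ xs (λ x → ∑ xs (g x)) (λ x → ∑ ys (g x))) (∑-+ ys (λ y → ∑ xs (g y)) (λ y → ∑ ys (g y))) ⟩
      (∑ xs (λ x → ∑ xs (g x)) + ∑ xs (λ x → ∑ ys (g x))) + (∑ ys (λ y → ∑ xs (g y)) + ∑ ys (λ y → ∑ ys (g y)))
        ≡⟨ rearrange (∑ xs (λ x → ∑ xs (g x))) (∑ xs (λ x → ∑ ys (g x)))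
                     (∑ ys (λ y → ∑ xs (g y))) (∑ ys (λ y → ∑ ys (g y))) ⟩
      (∑ xs (λ x → ∑ xs (g x)) + ∑ ys (λ y → ∑ ys (g y))) + (∑ xs (λ x → ∑ ys (g x)) + ∑ ys (λ y → ∑ xs (g y)))
        ≡⟨ cong (∑ xs (λ x → ∑ xs (g x)) + ∑ ys (λ y → ∑ ys (g y)) +_) cross ⟩
      (∑ xs (λ x → ∑ xs (g x)) + ∑ ys (λ y → ∑ ys (g y))) + ∑ xs (λ x → ∑ ys (λ y → g x y + g y x))
        ≤⟨ ℕ.+-mono-≤
             (ℕ.+-mono-≤ (∑²-divide g diag linear k xs (AllPairs.take⁺ (2 ^ k) sorted) uxs lenxs)
                         (∑²-divide g diag linear k ys (AllPairs.drop⁺ (2 ^ k) sorted) uys lenys))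
             (linear uxs uys (AllPairs-++⁻ xs sorted′) (AllPairs-++⁻ xs uq′)) ⟩
      (2 * length xs * k + 2 * length ys * k) + 2 * (length xs + length ys)
        ≡⟨ arith (length xs) (length ys) k ⟩
      2 * (length xs + length ys) * suc k
        ≡⟨ cong (λ l → 2 * l * suc k) (sym (List.length-++ xs)) ⟩
      2 * length (xs ++ ys) * suc k ∎)
    where
    open ℕ.≤-Reasoning
    xs = take (2 ^ k) zs
    ys = drop (2 ^ k) zs
    uxs : Unique xs
    uxs = AllPairs.take⁺ (2 ^ k) uq
    uys : Unique ys
    uys = AllPairs.drop⁺ (2 ^ k) uq
    sorted′ : AllPairs _⊑_ (xs ++ ys)
    sorted′ = subst (AllPairs _⊑_) (sym (List.take++drop≡id (2 ^ k) zs)) sorted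
    uq′ : Unique (xs ++ ys)
    uq′ = subst Unique (sym (List.take++drop≡id (2 ^ k) zs)) uq
    lenxs : length xs ≤ 2 ^ k
    lenxs = subst (_≤ 2 ^ k) (sym (List.length-take (2 ^ k) zs)) (ℕ.m⊓n≤m (2 ^ k) (length zs))
    lenys : length ys ≤ 2 ^ k
    lenys = subst₂ _≤_ (sym (List.length-drop (2 ^ k) zs))
      (trans (ℕ.m+n∸m≡n (2 ^ k) (2 ^ k + 0)) (ℕ.+-identityʳ (2 ^ k)))
      (ℕ.∸-monoˡ-≤ (2 ^ k) len)
    rearrange : ∀ a b c d → (a + b) + (c + d) ≡ (a + d) + (b + c)
    rearrange = solve 4 (λ a b c d → (a :+ b) :+ (c :+ d) := (a :+ d) :+ (b :+ c)) refl
    arith : ∀ a b k → (2 * a * k + 2 * b * k) + 2 * (a + b) ≡ 2 * (a + b) * suc k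
    arith = solve 3 (λ a b k → (con 2 :* a :* k :+ con 2 :* b :* k) :+ con 2 :* (a :+ b) :=
      con 2 :* (a :+ b) :* (con 1 :+ k)) refl
    cross : ∑ xs (λ x → ∑ ys (g x)) + ∑ ys (λ y → ∑ xs (g y)) ≡ ∑ xs (λ x → ∑ ys (λ y → g x y + g y x))
    cross = trans (cong (∑ xs (λ x → ∑ ys (g x)) +_) (∑-swap ys xs g))
      (trans (sym (∑-+ xs (λ x → ∑ ys (g x)) (λ x → ∑ ys (λ y → g y x))))
             (∑-cong xs (λ x → sym (∑-+ ys (g x) (λ y → g y x)))))

open Counting

open import Data.Rational using (ℚ; 0ℚ; 1ℚ; ½; _+_; _*_; _-_; -_; 1/_; _<_; _≤_; ∣_∣; positive; nonNegative; ≢-nonZero)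
open import Data.Rational.Properties
open import Data.Rational.Solver using (module +-*-Solver)
import Data.Rational.Unnormalised as ℚᵘ
import Data.Rational.Unnormalised.Properties as ℚᵘ
open import Data.Vec.Functional using (_∷_; [])
open +-*-Solver using (solve; _:+_; _:*_; _:-_; :-_; _:=_; con)

-- Points with supporting lines

pos+pos : ∀ {p q} → 0ℚ < p → 0ℚ < q → 0ℚ < p + q
pos+pos = +-mono-<

pos+nonneg : ∀ {p q} → 0ℚ < p → 0ℚ ≤ q → 0ℚ < p + q
pos+nonneg = +-mono-<-≤

nonneg+pos : ∀ {p q} → 0ℚ ≤ p → 0ℚ < q → 0ℚ < p + q
nonneg+pos = +-mono-≤-<

pos*pos : ∀ {p q} → 0ℚ < p → 0ℚ < q → 0ℚ < p * q
pos*pos {p} {q} 0<p 0<q = positive⁻¹ (p * q) {{pos*pos⇒pos p {{positive 0<p}} q {{positive 0<q}}}}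

nonneg*nonneg : ∀ {p q} → 0ℚ ≤ p → 0ℚ ≤ q → 0ℚ ≤ p * q
nonneg*nonneg {p} {q} 0≤p 0≤q =
  nonNegative⁻¹ (p * q) {{nonNeg*nonNeg⇒nonNeg p {{nonNegative 0≤p}} q {{nonNegative 0≤q}}}}

pos-factor : ∀ {p} q → 0ℚ < p → 0ℚ < p * q → 0ℚ < q
pos-factor {p} q 0<p 0<pq =
  *-cancelˡ-<-nonNeg p {{nonNegative (<⇒≤ 0<p)}} (subst (_< p * q) (sym (*-zeroʳ p)) 0<pq)

<⇒0<- : ∀ {p q} → p < q → 0ℚ < q - p
<⇒0<- {p} {q} p<q = subst (_< q - p) (+-inverseʳ p) (+-monoˡ-< (- p) p<q)

≤⇒0≤- : ∀ {p q} → p ≤ q → 0ℚ ≤ q - p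
≤⇒0≤- {p} {q} p≤q = subst (_≤ q - p) (+-inverseʳ p) (+-monoˡ-≤ (- p) p≤q)

0<-⇒< : ∀ {p q} → 0ℚ < q - p → p < q
0<-⇒< {p} {q} 0<q-p = subst₂ _<_ (+-identityˡ p) (eq q p) (+-monoˡ-< p 0<q-p)
  where
  eq : ∀ q p → q - p + p ≡ q
  eq = solve 2 (λ q p → q :- p :+ p := q) refl

pos≢0 : ∀ {p} → 0ℚ < p → p ≢ 0ℚ
pos≢0 0<p p≡0 = <-irrefl (sym p≡0) 0<p

p≤0⇒0≤-p : ∀ {p} → p ≤ 0ℚ → 0ℚ ≤ - p
p≤0⇒0≤-p {p} p≤0 = subst (0ℚ ≤_) (+-identityˡ (- p)) (≤⇒0≤- p≤0)

p<0⇒0<-p : ∀ {p} → p < 0ℚ → 0ℚ < - p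
p<0⇒0<-p {p} p<0 = subst (0ℚ <_) (+-identityˡ (- p)) (<⇒0<- p<0)

square-nonneg : ∀ p → 0ℚ ≤ p * p
square-nonneg p with ≤-total 0ℚ p
... | inj₁ 0≤p = nonneg*nonneg 0≤p 0≤p
... | inj₂ p≤0 = subst (0ℚ ≤_) (eq p) (nonneg*nonneg (p≤0⇒0≤-p p≤0) (p≤0⇒0≤-p p≤0))
  where
  eq : ∀ p → - p * - p ≡ p * p
  eq = solve 1 (λ p → :- p :* :- p := p :* p) refl

-- Adding the two bounds cancels `y` and leaves `(t - s) * x`. Chords with enclosed slopes thus
-- point to the right.
slope-bounds⇒pos : ∀ s t x y → s < t → 0ℚ < y - s * x → 0ℚ < t * x - y → 0ℚ < x
slope-bounds⇒pos s t x y s<t above below =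
  pos-factor x (<⇒0<- s<t) (subst (0ℚ <_) (eq s t x y) (pos+pos above below))
  where
  eq : ∀ s t x y → (y - s * x) + (t * x - y) ≡ (t - s) * x
  eq = solve 4 (λ s t x y → (y :- s :* x) :+ (t :* x :- y) := (t :- s) :* x) refl

norm²*pos : ∀ wx wy {x} → 0ℚ < wy ⊎ 0ℚ < wx → 0ℚ < x → 0ℚ < (wx * wx + wy * wy) * x
norm²*pos wx wy (inj₁ 0<wy) 0<x = pos*pos (nonneg+pos (square-nonneg wx) (pos*pos 0<wy 0<wy)) 0<x
norm²*pos wx wy (inj₂ 0<wx) 0<x = pos*pos (pos+nonneg (pos*pos 0<wx 0<wx) (square-nonneg wy)) 0<x

-- Both vectors point right, and for nonzero `wy` the last hypothesis makes the second at least as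
-- steep as the first in the same vertical direction, so they share a quadrant. Algebraically, two
-- positive terms and a nonnegative one would sum to zero.
obtuse-turn : ∀ wx wy x y → 0ℚ < wx → 0ℚ < x → 0ℚ < - (wx * x + wy * y) →
  0ℚ ≤ wy * (y * wx - wy * x) → ⊥
obtuse-turn wx wy x y 0<wx 0<x obtuse turn =
  pos≢0 (pos+pos (pos+nonneg (pos*pos 0<wx obtuse) turn) (norm²*pos wx wy (inj₂ 0<wx) 0<x)) (eq wx wy x y)
  where
  eq : ∀ wx wy x y →
    wx * - (wx * x + wy * y) + wy * (y * wx - wy * x) + (wx * wx + wy * wy) * x ≡ 0ℚ
  eq = solve 4 (λ wx wy x y →
    wx :* :- (wx :* x :+ wy :* y) :+ wy :* (y :* wx :- wy :* x) :+ (wx :* wx :+ wy :* wy) :* x := con 0ℚ) refl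

-- The vectors w, v, z have slopes σ(z) < s < σ(w) < t < σ(v), so v and z cannot both
-- make an obtuse angle with w: the slope of w would have to have both signs.
same-side-core : ∀ s′ s t t′ wx wy vx vy zx zy → s′ < s → s < t → t < t′ →
  0ℚ < wy - s * wx → 0ℚ < t * wx - wy →
  0ℚ < vy - t * vx → 0ℚ < t′ * vx - vy →
  0ℚ < zy - s′ * zx → 0ℚ < s * zx - zy →
  0ℚ < - (wx * vx + wy * vy) → 0ℚ < - (wx * zx + wy * zy) → ⊥
same-side-core s′ s t t′ wx wy vx vy zx zy s′<s s<t t<t′ w₁ w₂ v₁ v₂ z₁ z₂ wv wz = helper (≤-total 0ℚ wy)
  where
  0<wx = slope-bounds⇒pos s t wx wy s<t w₁ w₂
  0<vx = slope-bounds⇒pos t t′ vx vy t<t′ v₁ v₂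
  0<zx = slope-bounds⇒pos s′ s zx zy s′<s z₁ z₂
  eqᵥ : ∀ t wx wy vx vy → wx * (vy - t * vx) + vx * (t * wx - wy) ≡ vy * wx - wy * vx
  eqᵥ = solve 5 (λ t wx wy vx vy → wx :* (vy :- t :* vx) :+ vx :* (t :* wx :- wy) := vy :* wx :- wy :* vx) refl
  eqz : ∀ s wx wy zx zy →
    - wy * (zx * (wy - s * wx) + wx * (s * zx - zy)) ≡ wy * (zy * wx - wy * zx)
  eqz = solve 5 (λ s wx wy zx zy →
    :- wy :* (zx :* (wy :- s :* wx) :+ wx :* (s :* zx :- zy)) := wy :* (zy :* wx :- wy :* zx)) refl
  helper : 0ℚ ≤ wy ⊎ wy ≤ 0ℚ → ⊥
  helper (inj₁ 0≤wy) = obtuse-turn wx wy vx vy 0<wx 0<vx wv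
    (nonneg*nonneg 0≤wy (subst (0ℚ ≤_) (eqᵥ t wx wy vx vy) (<⇒≤ (pos+pos (pos*pos 0<wx v₁) (pos*pos 0<vx w₂)))))
  helper (inj₂ wy≤0) = obtuse-turn wx wy zx zy 0<wx 0<zx wz
    (subst (0ℚ ≤_) (eqz s wx wy zx zy)
      (nonneg*nonneg (p≤0⇒0≤-p wy≤0) (<⇒≤ (pos+pos (pos*pos 0<zx w₁) (pos*pos 0<wx z₂)))))

-- Since σ(z) < σ(v), the two dot products force wy > 0; either sign of wx then contradicts one of them.
opposite-side-core : ∀ s s′ t′ t wx wy vx vy zx zy → s < s′ → s′ ≤ t′ → t′ < t →
  0ℚ < s * wx - wy → 0ℚ < t * wx - wy →
  0ℚ < zy - s * zx → 0ℚ < s′ * zx - zy →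
  0ℚ < vy - t′ * vx → 0ℚ < t * vx - vy →
  0ℚ < wx * vx + wy * vy → 0ℚ < - (wx * zx + wy * zy) → ⊥
opposite-side-core s s′ t′ t wx wy vx vy zx zy s<s′ s′≤t′ t′<t w₁ w₂ z₁ z₂ v₁ v₂ wv wz = helper (≤-total 0ℚ wx)
  where
  0<vx = slope-bounds⇒pos t′ t vx vy t′<t v₁ v₂
  0<zx = slope-bounds⇒pos s s′ zx zy s<s′ z₁ z₂
  eq₁ : ∀ s′ t′ vx vy zx zy →
    zx * (vy - t′ * vx) + vx * (s′ * zx - zy) + (t′ - s′) * (vx * zx) ≡ vy * zx - zy * vx
  eq₁ = solve 6 (λ s′ t′ vx vy zx zy →
    zx :* (vy :- t′ :* vx) :+ vx :* (s′ :* zx :- zy) :+ (t′ :- s′) :* (vx :* zx) := vy :* zx :- zy :* vx) refl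
  eq₂ : ∀ wx wy vx vy zx zy →
    zx * (wx * vx + wy * vy) + vx * - (wx * zx + wy * zy) ≡ (vy * zx - zy * vx) * wy
  eq₂ = solve 6 (λ wx wy vx vy zx zy →
    zx :* (wx :* vx :+ wy :* vy) :+ vx :* :- (wx :* zx :+ wy :* zy) := (vy :* zx :- zy :* vx) :* wy) refl
  cross : 0ℚ < vy * zx - zy * vx
  cross = subst (0ℚ <_) (eq₁ s′ t′ vx vy zx zy)
    (pos+nonneg (pos+pos (pos*pos 0<zx v₁) (pos*pos 0<vx z₂))
      (nonneg*nonneg (≤⇒0≤- s′≤t′) (<⇒≤ (pos*pos 0<vx 0<zx))))
  0<wy : 0ℚ < wy
  -- Weighting the two dot products by `zx` and `vx` eliminates `wx`.
  0<wy = pos-factor wy cross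
    (subst (0ℚ <_) (eq₂ wx wy vx vy zx zy) (pos+pos (pos*pos 0<zx wv) (pos*pos 0<vx wz)))
  eq₃ : ∀ s wx wy x y → (wx * - (wx * x + wy * y) + wx * (wy * (y - s * x))) +
    (wy * x * (s * wx - wy) + (wx * wx + wy * wy) * x) ≡ 0ℚ
  eq₃ = solve 5 (λ s wx wy x y → (wx :* :- (wx :* x :+ wy :* y) :+ wx :* (wy :* (y :- s :* x))) :+
    (wy :* x :* (s :* wx :- wy) :+ (wx :* wx :+ wy :* wy) :* x) := con 0ℚ) refl
  eq₄ : ∀ t wx wy x y → (- wx * (wx * x + wy * y) + - wx * (wy * (t * x - y))) +
    (wy * x * (t * wx - wy) + (wx * wx + wy * wy) * x) ≡ 0ℚ
  eq₄ = solve 5 (λ t wx wy x y → (:- wx :* (wx :* x :+ wy :* y) :+ :- wx :* (wy :* (t :* x :- y))) :+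
    (wy :* x :* (t :* wx :- wy) :+ (wx :* wx :+ wy :* wy) :* x) := con 0ℚ) refl
  -- If `wx` is nonnegative, `s * wx > wy > 0` makes `s` positive, so `z` lies in the open first
  -- quadrant and cannot make an obtuse angle with `w`. Otherwise `t` is negative, and `v` points
  -- down and right while `w` points up and left.
  helper : 0ℚ ≤ wx ⊎ wx ≤ 0ℚ → ⊥
  helper (inj₁ 0≤wx) = pos≢0
    (nonneg+pos (+-mono-≤ (nonneg*nonneg 0≤wx (<⇒≤ wz)) (nonneg*nonneg 0≤wx (<⇒≤ (pos*pos 0<wy z₁))))
      (pos+pos (pos*pos (pos*pos 0<wy 0<zx) w₁) (norm²*pos wx wy (inj₁ 0<wy) 0<zx)))
    (eq₃ s wx wy zx zy)
  helper (inj₂ wx≤0) = pos≢0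
    (nonneg+pos (+-mono-≤ (nonneg*nonneg (p≤0⇒0≤-p wx≤0) (<⇒≤ wv))
                          (nonneg*nonneg (p≤0⇒0≤-p wx≤0) (<⇒≤ (pos*pos 0<wy v₂))))
      (pos+pos (pos*pos (pos*pos 0<wy 0<vx) w₂) (norm²*pos wx wy (inj₁ 0<wy) 0<vx)))
    (eq₄ t wx wy vx vy)

sign : Bool → ℚ
sign true  = 1ℚ
sign false = - 1ℚ

sign² : ∀ b → sign b * sign b ≡ 1ℚ
sign² true  = refl
sign² false = refl

sign-not : ∀ b → sign (not b) ≡ - sign b
sign-not true  = refl
sign-not false = refl

module Supported {n} (X Y t : Fin n → ℚ) (side : Fin n → Bool) where

  dot : Fin n → Fin n → Fin n → ℚ
  dot o p q = (X p - X o) * (X q - X o) + (Y p - Y o) * (Y q - Y o)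

  -- The line of slope t p through p supports the points from above if side p is true, from below otherwise.
  Supporting : Set
  Supporting = ∀ p j → j ≢ p → 0ℚ < sign (side p) * (t p * (X j - X p) - (Y j - Y p))

  module _ (supp : Supporting) where

    private
      supp′ : ∀ {b} p j → side p ≡ b → t j ≢ t p → 0ℚ < sign b * (t p * (X j - X p) - (Y j - Y p))
      supp′ p j refl ≢t = supp p j λ {refl → ≢t refl}

      flip₁ : ∀ e s xp xq yp yq → e * (s * (xq - xp) - (yq - yp)) ≡ e * (yp - yq) - s * (e * (xp - xq))
      flip₁ = solve 6 (λ e s xp xq yp yq →
        e :* (s :* (xq :- xp) :- (yq :- yp)) := e :* (yp :- yq) :- s :* (e :* (xp :- xq))) refl

      flip₂ : ∀ e s xp xq yp yq → e * (s * (xp - xq) - (yp - yq)) ≡ s * (e * (xp - xq)) - e * (yp - yq)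
      flip₂ = solve 6 (λ e s xp xq yp yq →
        e :* (s :* (xp :- xq) :- (yp :- yq)) := s :* (e :* (xp :- xq)) :- e :* (yp :- yq)) refl

      flip₃ : ∀ e s xp xq yp yq → - e * (s * (xp - xq) - (yp - yq)) ≡ s * (e * (xq - xp)) - e * (yq - yp)
      flip₃ = solve 6 (λ e s xp xq yp yq →
        :- e :* (s :* (xp :- xq) :- (yp :- yq)) := s :* (e :* (xq :- xp)) :- e :* (yq :- yp)) refl

      flip₄ : ∀ e s xp xq yp yq → - e * (s * (xq - xp) - (yq - yp)) ≡ e * (yq - yp) - s * (e * (xq - xp))
      flip₄ = solve 6 (λ e s xp xq yp yq →
        :- e :* (s :* (xq :- xp) :- (yq :- yp)) := e :* (yq :- yp) :- s :* (e :* (xq :- xp))) refl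

      unsign : ∀ b {r} q → r ≡ (sign b * sign b) * q → 0ℚ < q → 0ℚ < r
      unsign b q r≡ = subst (0ℚ <_) (sym (trans r≡ (trans (cong (_* q) (sign² b)) (*-identityˡ q))))

    -- The supporting lines at its two ends enclose the slope of a chord, so `same-side-core`
    -- applies to the chords `ba`, `b′b` and `aa′`. Scaling all chords by `e` treats both sides at
    -- once and disappears from the dot products because `e * e` is `1`.
    no-outward-path : ∀ {a a′ b b′} → side a ≡ side b → side a′ ≡ side b → side b′ ≡ side b →
      t a′ < t a → t a < t b → t b < t b′ → 0ℚ < dot b a b′ → 0ℚ < dot a b a′ → ⊥
    no-outward-path {a} {a′} {b} {b′} sa sa′ sb′ a′<a a<b b<b′ acute₁ acute₂ =
      same-side-core (t a′) (t a) (t b) (t b′)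
        (e * (X a - X b)) (e * (Y a - Y b)) (e * (X b - X b′)) (e * (Y b - Y b′))
        (e * (X a′ - X a)) (e * (Y a′ - Y a)) a′<a a<b b<b′
        (subst (0ℚ <_) (flip₁ e (t a) (X a) (X b) (Y a) (Y b)) (supp′ a b sa (λ q → <-irrefl (sym q) a<b)))
        (subst (0ℚ <_) (flip₂ e (t b) (X a) (X b) (Y a) (Y b)) (supp′ b a refl (λ q → <-irrefl q a<b)))
        (subst (0ℚ <_) (flip₁ e (t b) (X b) (X b′) (Y b) (Y b′)) (supp′ b b′ refl (λ q → <-irrefl (sym q) b<b′)))
        (subst (0ℚ <_) (flip₂ e (t b′) (X b) (X b′) (Y b) (Y b′)) (supp′ b′ b sb′ (λ q → <-irrefl q b<b′)))
        (subst (0ℚ <_) (flip₁ e (t a′) (X a′) (X a) (Y a′) (Y a)) (supp′ a′ a sa′ (λ q → <-irrefl (sym q) a′<a)))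
        (subst (0ℚ <_) (flip₂ e (t a) (X a′) (X a) (Y a′) (Y a)) (supp′ a a′ sa (λ q → <-irrefl q a′<a)))
        (unsign (side b) (dot b a b′) (eq₁ e (X a) (X b) (X b′) (Y a) (Y b) (Y b′)) acute₁)
        (unsign (side b) (dot a b a′) (eq₂ e (X a) (X b) (X a′) (Y a) (Y b) (Y a′)) acute₂)
      where
      e = sign (side b)
      eq₁ : ∀ e xa xb xc ya yb yc →
        - (e * (xa - xb) * (e * (xb - xc)) + e * (ya - yb) * (e * (yb - yc))) ≡
        (e * e) * ((xa - xb) * (xc - xb) + (ya - yb) * (yc - yb))
      eq₁ = solve 7 (λ e xa xb xc ya yb yc →
        :- (e :* (xa :- xb) :* (e :* (xb :- xc)) :+ e :* (ya :- yb) :* (e :* (yb :- yc))) :=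
        (e :* e) :* ((xa :- xb) :* (xc :- xb) :+ (ya :- yb) :* (yc :- yb))) refl
      eq₂ : ∀ e xa xb xc ya yb yc →
        - (e * (xa - xb) * (e * (xc - xa)) + e * (ya - yb) * (e * (yc - ya))) ≡
        (e * e) * ((xb - xa) * (xc - xa) + (yb - ya) * (yc - ya))
      eq₂ = solve 7 (λ e xa xb xc ya yb yc →
        :- (e :* (xa :- xb) :* (e :* (xc :- xa)) :+ e :* (ya :- yb) :* (e :* (yc :- ya))) :=
        (e :* e) :* ((xb :- xa) :* (xc :- xa) :+ (yb :- ya) :* (yc :- ya))) refl

    -- The chord `ab` joins opposite sides, so the supporting lines at its ends bound it from the
    -- same direction; only the chords `a′a` and `b′b` have enclosed slopes. This is the
    -- configuration of `opposite-side-core`.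
    no-inward-path : ∀ {a a′ b b′} → side b ≡ not (side a) → side a′ ≡ side a → side b′ ≡ not (side a) →
      t a < t a′ → t a′ ≤ t b′ → t b′ < t b → 0ℚ < dot b a b′ → 0ℚ < dot a b a′ → ⊥
    no-inward-path {a} {a′} {b} {b′} sb sa′ sb′ a<a′ a′≤b′ b′<b acute₁ acute₂ =
      opposite-side-core (t a) (t a′) (t b′) (t b)
        (e * (X b - X a)) (e * (Y b - Y a)) (e * (X b - X b′)) (e * (Y b - Y b′))
        (e * (X a - X a′)) (e * (Y a - Y a′)) a<a′ a′≤b′ b′<b
        (subst (0ℚ <_) (flip₂ e (t a) (X b) (X a) (Y b) (Y a)) (supp′ a b refl (λ q → <-irrefl (sym q) a<b)))
        (subst (0ℚ <_) (flip₃ e (t b) (X a) (X b) (Y a) (Y b)) (neg b a sb (λ q → <-irrefl q a<b)))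
        (subst (0ℚ <_) (flip₁ e (t a) (X a) (X a′) (Y a) (Y a′)) (supp′ a a′ refl (λ q → <-irrefl (sym q) a<a′)))
        (subst (0ℚ <_) (flip₂ e (t a′) (X a) (X a′) (Y a) (Y a′)) (supp′ a′ a sa′ (λ q → <-irrefl q a<a′)))
        (subst (0ℚ <_) (flip₄ e (t b′) (X b′) (X b) (Y b′) (Y b)) (neg b′ b sb′ (λ q → <-irrefl (sym q) b′<b)))
        (subst (0ℚ <_) (flip₃ e (t b) (X b′) (X b) (Y b′) (Y b)) (neg b b′ sb (λ q → <-irrefl q b′<b)))
        (unsign (side a) (dot b a b′) (eq₁ e (X a) (X b) (X b′) (Y a) (Y b) (Y b′)) acute₁)
        (unsign (side a) (dot a b a′) (eq₂ e (X a) (X b) (X a′) (Y a) (Y b) (Y a′)) acute₂)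
      where
      e = sign (side a)
      a<b : t a < t b
      a<b = <-trans a<a′ (≤-<-trans a′≤b′ b′<b)
      neg : ∀ p j → side p ≡ not (side a) → t j ≢ t p → 0ℚ < - e * (t p * (X j - X p) - (Y j - Y p))
      neg p j sp ≢t = subst (λ s → 0ℚ < s * (t p * (X j - X p) - (Y j - Y p))) (sign-not (side a)) (supp′ p j sp ≢t)
      eq₁ : ∀ e xa xb xc ya yb yc →
        e * (xb - xa) * (e * (xb - xc)) + e * (yb - ya) * (e * (yb - yc)) ≡
        (e * e) * ((xa - xb) * (xc - xb) + (ya - yb) * (yc - yb))
      eq₁ = solve 7 (λ e xa xb xc ya yb yc →
        e :* (xb :- xa) :* (e :* (xb :- xc)) :+ e :* (yb :- ya) :* (e :* (yb :- yc)) :=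
        (e :* e) :* ((xa :- xb) :* (xc :- xb) :+ (ya :- yb) :* (yc :- yb))) refl
      eq₂ : ∀ e xa xb xc ya yb yc →
        - (e * (xb - xa) * (e * (xa - xc)) + e * (yb - ya) * (e * (ya - yc))) ≡
        (e * e) * ((xb - xa) * (xc - xa) + (yb - ya) * (yc - ya))
      eq₂ = solve 7 (λ e xa xb xc ya yb yc →
        :- (e :* (xb :- xa) :* (e :* (xa :- xc)) :+ e :* (yb :- ya) :* (e :* (ya :- yc))) :=
        (e :* e) :* ((xb :- xa) :* (xc :- xa) :+ (yb :- ya) :* (yc :- ya))) refl

    -- With equal slopes each point would lie strictly on the inner side of the parallel line
    -- through the other, and the two positive quantities sum to zero. Hence ties in the sorted
    -- order occur only between opposite sides.
    same-side⇒t≢ : ∀ {p q} → side p ≡ side q → p ≢ q → t p ≢ t q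
    same-side⇒t≢ {p} {q} s p≢q tp≡tq = pos≢0
      (pos+pos (subst (λ b → 0ℚ < sign b * (t p * (X q - X p) - (Y q - Y p))) s (supp p q (λ q≡p → p≢q (sym q≡p))))
               (subst (λ r → 0ℚ < sign (side q) * (r * (X p - X q) - (Y p - Y q))) (sym tp≡tq) (supp q p p≢q)))
      (eq (sign (side q)) (t p) (X p) (X q) (Y p) (Y q))
      where
      eq : ∀ e s xp xq yp yq → e * (s * (xq - xp) - (yq - yp)) + e * (s * (xp - xq) - (yp - yq)) ≡ 0ℚ
      eq = solve 6 (λ e s xp xq yp yq →
        e :* (s :* (xq :- xp) :- (yq :- yp)) :+ e :* (s :* (xp :- xq) :- (yp :- yq)) := con 0ℚ) refl

-- The edge bound for points with supporting lines.

module EdgeBound {n} (X Y t : Fin n → ℚ) (side : Fin n → Bool) (G : Graph n) where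
  open Graph G
  open Supported X Y t side

  -- The acute angle is at `v`, an end of the path `v u w`, and not at its middle vertex `u`.
  Acute : Set
  Acute = ∀ u v w → u ~ v → u ~ w → v ≢ w → 0ℚ < dot v u w

  module _ (supp : Supporting) (acute : Acute) where

    Same Opposite : Fin n → Fin n → Set
    Same     a b = a ~ b × side a ≡ side b
    Opposite a b = a ~ b × side b ≡ not (side a)

    same? : ∀ a b → Dec (Same a b)
    same? a b = a ~? b ×-dec side a Bool.≟ side b

    opposite? : ∀ a b → Dec (Opposite a b)
    opposite? a b = a ~? b ×-dec side b Bool.≟ not (side a)

    same⊎opposite : ∀ {a b} → a ~ b → Same a b ⊎ Opposite a b
    same⊎opposite {a} {b} e with side a Bool.≟ side b
    ... | yes s = inj₁ (e , s)
    ... | no ¬s = inj₂ (e , Bool.¬-not (λ s → ¬s (sym s)))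

    connex : ∀ {p q} → side p ≡ side q → p ≢ q → t p < t q ⊎ t q < t p
    connex {p} {q} s p≢q with <-cmp (t p) (t q)
    ... | tri< lt _ _ = inj₁ lt
    ... | tri≈ _ eq _ = ⊥-elim (same-side⇒t≢ supp s p≢q eq)
    ... | tri> _ _ gt = inj₂ gt

    connex′ : ∀ {p q} → side p ≡ side q → p ≢ q → t q < t p ⊎ t p < t q
    connex′ s p≢q = connex (sym s) (λ e → p≢q (sym e))

    low<high : ∀ {p q} → t p ≤ t q → side p ≡ side q → p ≢ q → t p < t q
    low<high p≤q s p≢q = ≰⇒> λ q≤p → same-side⇒t≢ supp s p≢q (≤-antisym p≤q q≤p)

    t<⇒≢ : ∀ {p q} → t p < t q → p ≢ q
    t<⇒≢ lt refl = <-irrefl refl lt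

    _t<?_ : ∀ p q → Dec (t p < t q)
    p t<? q = t p <? t q

    w : Fin n × Fin n → ℕ
    w (i , j) = ⟦ (i Fin.<? j) ×-dec (i ~? j) ⟧

    w-symmetrized : ∀ a b → w (a , b) ℕ.+ w (b , a) ℕ.≤ ⟦ same? a b ⟧ ℕ.+ ⟦ opposite? a b ⟧
    w-symmetrized a b with (a Fin.<? b) ×-dec (a ~? b) | (b Fin.<? a) ×-dec (b ~? a)
    ... | yes (a<b , _) | yes (b<a , _) = ⊥-elim (Fin.<-asym {x = a} {y = b} a<b b<a)
    ... | yes (_ , e)   | no _          = ⟦⟧-⊎ (yes e) (same? a b) (opposite? a b) same⊎opposite
    ... | no _          | yes (_ , e)   = ⟦⟧-⊎ (yes (symm e)) (same? a b) (opposite? a b) same⊎opposite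
    ... | no _          | no _          = ℕ.z≤n

    w-diagonal : ∀ a → w (a , a) ≡ 0
    w-diagonal a with (a Fin.<? a) ×-dec (a ~? a)
    ... | yes (a<a , _) = ⊥-elim (Fin.<-irrefl {x = a} refl a<a)
    ... | no _          = refl

    -- Same-side and opposite-side edges are counted separately by `∑-bipartite`, and each kind
    -- contributes one term of the factor `2`. Same-side edges are extremal when they reach outward,
    -- to the least `t` below or the greatest `t` above; for opposite sides both orders are
    -- reversed.
    between-parts : ∀ {xs ys} → Unique xs → Unique ys → (∀ {a b} → a ∈ xs → b ∈ ys → t a ≤ t b) →
      (∀ {a b} → a ∈ xs → b ∈ ys → a ≢ b) →
      ∑ xs (λ a → ∑ ys (λ b → w (a , b) ℕ.+ w (b , a))) ℕ.≤ 2 ℕ.* (length xs ℕ.+ length ys)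
    between-parts {xs} {ys} uxs uys low≤high disjoint = begin
      ∑ xs (λ a → ∑ ys (λ b → w (a , b) ℕ.+ w (b , a)))
        ≤⟨ ∑-mono xs (λ {a} _ → ∑-mono ys (λ {b} _ → w-symmetrized a b)) ⟩
      ∑ xs (λ a → ∑ ys (λ b → ⟦ same? a b ⟧ ℕ.+ ⟦ opposite? a b ⟧))
        ≡⟨ ∑-cong xs (λ a → ∑-+ ys (λ b → ⟦ same? a b ⟧) (λ b → ⟦ opposite? a b ⟧)) ⟩
      ∑ xs (λ a → ∑ ys (λ b → ⟦ same? a b ⟧) ℕ.+ ∑ ys (λ b → ⟦ opposite? a b ⟧))
        ≡⟨ ∑-+ xs (λ a → ∑ ys (λ b → ⟦ same? a b ⟧)) (λ a → ∑ ys (λ b → ⟦ opposite? a b ⟧)) ⟩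
      ∑ xs (λ a → ∑ ys (λ b → ⟦ same? a b ⟧)) ℕ.+ ∑ xs (λ a → ∑ ys (λ b → ⟦ opposite? a b ⟧))
        ≤⟨ ℕ.+-mono-≤
             (∑-bipartite same? _t<?_ (λ b b′ → b′ t<? b) uxs uys
               (λ (_ , s) (_ , s′) → connex (trans s (sym s′)))
               (λ (_ , s) (_ , s′) → connex′ (trans (sym s) s′))
               (λ i _ j _ (e , s) (e′ , s′) (e″ , s″) a′<a b<b′ →
                 no-outward-path supp s s′ (trans (sym s″) s) a′<a
                   (low<high (low≤high i j) s (disjoint i j)) b<b′
                   (acute _ _ _ e e″ (t<⇒≢ b<b′))
                   (acute _ _ _ (symm e) (symm e′) (λ a≡a′ → t<⇒≢ a′<a (sym a≡a′)))))
             (∑-bipartite opposite? (λ a a′ → a′ t<? a) _t<?_ uxs uys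
               (λ (_ , s) (_ , s′) → connex′ (Bool.not-injective (trans (sym s) s′)))
               (λ (_ , s) (_ , s′) → connex (trans s (sym s′)))
               (λ i i′ j j′ (e , s) (e′ , s′) (e″ , s″) a<a′ b′<b →
                 no-inward-path supp s (Bool.not-injective (trans (sym s′) s)) s″ a<a′ (low≤high i′ j′) b′<b
                   (acute _ _ _ e e″ (λ b≡b′ → t<⇒≢ b′<b (sym b≡b′)))
                   (acute _ _ _ (symm e) (symm e′) (t<⇒≢ a<a′)))) ⟩
      (length xs ℕ.+ length ys) ℕ.+ (length xs ℕ.+ length ys)
        ≡⟨ cong (length xs ℕ.+ length ys ℕ.+_) (sym (ℕ.+-identityʳ _)) ⟩
      2 ℕ.* (length xs ℕ.+ length ys) ∎
      where open ℕ.≤-Reasoning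

    edgeCount-bound : ∀ k → n ℕ.≤ 2 ℕ.^ k → edgeCount ℕ.≤ 2 ℕ.* n ℕ.* k
    edgeCount-bound k n≤2^k = begin
      edgeCount
        ≡⟨ length-filter-∑ (λ (i , j) → (i Fin.<? j) ×-dec (i ~? j)) (cartesianProduct V V) ⟩
      ∑ (cartesianProduct V V) w
        ≡⟨ ∑-cartesianProduct V V w ⟩
      ∑ V (λ i → ∑ V (λ j → w (i , j)))
        ≡⟨ ∑-cong V (λ i → ∑-↭ (λ j → w (i , j)) (↭-sym S↭V)) ⟩
      ∑ V (λ i → ∑ S (λ j → w (i , j)))
        ≡⟨ ∑-↭ (λ i → ∑ S (λ j → w (i , j))) (↭-sym S↭V) ⟩
      ∑ S (λ i → ∑ S (λ j → w (i , j)))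
        ≤⟨ ∑²-divide (λ i j → w (i , j)) w-diagonal between-parts k S sorted unique
             (subst (ℕ._≤ 2 ℕ.^ k) (sym |S|≡n) n≤2^k) ⟩
      2 ℕ.* length S ℕ.* k
        ≡⟨ cong (λ l → 2 ℕ.* l ℕ.* k) |S|≡n ⟩
      2 ℕ.* n ℕ.* k ∎
      where
      open ℕ.≤-Reasoning
      byT : DecTotalOrder _ _ _
      byT = On.decTotalOrder ≤-decTotalOrder t
      V = allFin n
      S = Sort.sort byT V
      S↭V : S ↭ V
      S↭V = Sort.sort-↭ byT V
      sorted : AllPairs (λ i j → t i ≤ t j) S
      sorted = Sorted.Sorted⇒AllPairs (DecTotalOrder.totalOrder byT) (Sort.sort-↗ byT V)
      unique : Unique S
      unique = PermSetoid.Unique-resp-↭ (setoid (Fin n)) (↭⇒↭ₛ (↭-sym S↭V)) (AllPairs.tabulate⁺ (λ i≢j → i≢j))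
      |S|≡n : length S ≡ n
      |S|≡n = trans (Perm.↭-length S↭V) (List.length-tabulate {n = n} (λ i → i))

-- Supporting lines from orientations

p<p+pos : ∀ p {q} → 0ℚ < q → p < p + q
p<p+pos p {q} 0<q = subst (_< p + q) (+-identityʳ p) (+-monoʳ-< p 0<q)

-- The candidate `t` is lowered, by density, to a point between `l` and the new value whenever it is
-- not already below that value.
above-and-below : ∀ {m} {R : Fin m → Set} (R? : ∀ k → Dec (R k)) (f : Fin m → ℚ) l →
  (∀ k → R k → l < f k) → ∃ λ t → l < t × ∀ k → R k → t < f k
above-and-below {zero}  R? f l l<f = l + 1ℚ , p<p+pos l (positive⁻¹ 1ℚ) , λ ()
above-and-below {suc m} R? f l l<f with above-and-below (λ k → R? (suc k)) (λ k → f (suc k)) l (λ k → l<f (suc k)) | R? zero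
... | t , l<t , t<f | no ¬r = t , l<t , λ {zero r → ⊥-elim (¬r r); (suc k) r → t<f k r}
... | t , l<t , t<f | yes r with <-cmp t (f zero)
...   | tri< t<f₀ _ _ = t , l<t , λ {zero _ → t<f₀; (suc k) r → t<f k r}
...   | tri≈ _ t≡f₀ _ = let (m , l<m , m<f₀) = <-dense (l<f zero r) in
  m , l<m , λ {zero _ → m<f₀; (suc k) r → <-trans m<f₀ (subst (_< f (suc k)) t≡f₀ (t<f k r))}
...   | tri> _ _ f₀<t = let (m , l<m , m<f₀) = <-dense (l<f zero r) in
  m , l<m , λ {zero _ → m<f₀; (suc k) r → <-trans m<f₀ (<-trans f₀<t (t<f k r))}

below-all : ∀ {m} (f : Fin m → ℚ) → ∃ λ l → ∀ k → l < f k
below-all {zero}  f = 0ℚ , λ ()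
below-all {suc m} f with below-all (λ k → f (suc k))
... | l , l<f with l <? f zero
...   | yes l<f₀ = l , λ {zero → l<f₀; (suc k) → l<f k}
...   | no  l≮f₀ = f zero - 1ℚ , λ {zero → f₀-1<f₀; (suc k) → <-trans f₀-1<f₀ (≤-<-trans (≮⇒≥ l≮f₀) (l<f k))}
  where
  f₀-1<f₀ : f zero - 1ℚ < f zero
  f₀-1<f₀ = subst (f zero - 1ℚ <_) (+-identityʳ (f zero)) (+-monoʳ-< (f zero) (negative⁻¹ (- 1ℚ)))

-- Induction on the lower family: when the threshold does not exceed the new lower value, it is
-- replaced by one just above that value and below the required values of `g`. The replacement is
-- larger, so the earlier lower bounds persist.
separate : ∀ {m m′} {L : Fin m → Set} {R : Fin m′ → Set} (L? : ∀ j → Dec (L j)) (R? : ∀ k → Dec (R k))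
  (f : Fin m → ℚ) (g : Fin m′ → ℚ) → (∀ j k → L j → R k → f j < g k) →
  ∃ λ t → (∀ j → L j → f j < t) × (∀ k → R k → t < g k)
separate {zero}  L? R? f g f<g with below-all g
... | t , t<g = t , (λ ()) , λ k _ → t<g k
separate {suc m} L? R? f g f<g with separate (λ j → L? (suc j)) R? (λ j → f (suc j)) g (λ j → f<g (suc j)) | L? zero
... | t , f<t , t<g | no ¬l = t , (λ {zero l → ⊥-elim (¬l l); (suc j) l → f<t j l}) , t<g
... | t , f<t , t<g | yes l with f zero <? t
...   | yes f₀<t = t , (λ {zero _ → f₀<t; (suc j) l → f<t j l}) , t<g
...   | no  f₀≮t with above-and-below R? g (f zero) (λ k → f<g zero k l)
...     | s , f₀<s , s<g = s , (λ {zero _ → f₀<s; (suc j) l → <-trans (f<t j l) (≤-<-trans (≮⇒≥ f₀≮t) f₀<s)}) , s<g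

-- The quotient of `v` by `u`, made total by the junk value `0` so that it can be formed for every
-- index, the base point included.
slope : ∀ u v → ∃ λ q → u ≢ 0ℚ → q * u ≡ v
slope u v with u ≟ 0ℚ
... | yes u≡0 = 0ℚ , λ u≢0 → ⊥-elim (u≢0 u≡0)
... | no  u≢0 = v * r , λ _ → trans (*-assoc v r u) (trans (cong (v *_) (*-inverseˡ u)) (*-identityʳ v))
  where
  instance _ = ≢-nonZero u≢0
  r = 1/ u

neg≢0 : ∀ {p} → 0ℚ < - p → p ≢ 0ℚ
neg≢0 0<-p refl = <-irrefl refl 0<-p

slope-order : ∀ uj uk vj vk q r → q * uj ≡ vj → r * uk ≡ vk →
  0ℚ < uj → 0ℚ < - uk → 0ℚ < uk * vj - uj * vk → q < r
slope-order uj uk _ _ q r refl refl 0<uj 0<-uk cross =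
  0<-⇒< (pos-factor (r - q) (pos*pos 0<uj 0<-uk) (subst (0ℚ <_) (eq uj uk q r) cross))
  where
  eq : ∀ uj uk q r → uk * (q * uj) - uj * (r * uk) ≡ uj * - uk * (r - q)
  eq = solve 4 (λ uj uk q r → uk :* (q :* uj) :- uj :* (r :* uk) := uj :* :- uk :* (r :- q)) refl

below-line : ∀ t q u v → q * u ≡ v → u ≢ 0ℚ → (0ℚ < u → q < t) → (0ℚ < - u → t < q) → 0ℚ < t * u - v
below-line t q u _ refl u≢0 right left with <-cmp 0ℚ u
... | tri≈ _ 0≡u _ = ⊥-elim (u≢0 (sym 0≡u))
... | tri< 0<u _ _ = subst (0ℚ <_) (eq t q u) (pos*pos (<⇒0<- (right 0<u)) 0<u)
  where
  eq : ∀ t q u → (t - q) * u ≡ t * u - q * u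
  eq = solve 3 (λ t q u → (t :- q) :* u := t :* u :- q :* u) refl
... | tri> _ _ u<0 = subst (0ℚ <_) (eq t q u) (pos*pos (<⇒0<- (left (p<0⇒0<-p u<0))) (p<0⇒0<-p u<0))
  where
  eq : ∀ t q u → (q - t) * - u ≡ t * u - q * u
  eq = solve 3 (λ t q u → (q :- t) :* :- u := t :* u :- q :* u) refl

-- A line through the origin passes above a point on the right when its slope is larger than that of
-- the point, and above a point on the left when it is smaller. The orientation hypothesis puts
-- every slope on the right below every slope on the left, so `separate` finds one between them.
supporting-slope : ∀ {m} (u v : Fin m → ℚ) →
  (∀ j k → 0ℚ < u j → 0ℚ < - u k → 0ℚ < u k * v j - u j * v k) →
  ∃ λ t → ∀ j → u j ≢ 0ℚ → 0ℚ < t * u j - v j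
supporting-slope u v cross =
  let (t , right , left) = separate (λ j → 0ℚ <? u j) (λ k → 0ℚ <? - u k) σ σ λ j k 0<uj 0<-uk →
        slope-order (u j) (u k) (v j) (v k) (σ j) (σ k) (σ-eq j (pos≢0 0<uj)) (σ-eq k (neg≢0 0<-uk))
          0<uj 0<-uk (cross j k 0<uj 0<-uk)
  in t , λ j u≢0 → below-line t (σ j) (u j) (v j) (σ-eq j u≢0) u≢0 (right j) (left j)
  where
  σ : _ → ℚ
  σ j = proj₁ (slope (u j) (v j))
  σ-eq : ∀ j → u j ≢ 0ℚ → σ j * u j ≡ v j
  σ-eq j = proj₂ (slope (u j) (v j))

-- The coordinates in the directions (δ , 1) and (-1 , δ), which are orthogonal and of equal length.
module Rotated {n} (δ : ℚ) (x y : Fin n → ℚ) where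

  u : Fin n → Fin n → ℚ
  u p j = (y j - y p) + δ * (x j - x p)

  cross : Fin n → Fin n → Fin n → ℚ
  cross p j k = (x j - x p) * (y k - y p) - (x k - x p) * (y j - y p)

  -- In the rotated coordinates, p is a vertex of the upper or of the lower hull.
  OnHull : Fin n → Set
  OnHull p = (∀ j → j ≢ p → u p j ≢ 0ℚ) ×
    ((∀ j k → 0ℚ < u p j → 0ℚ < - u p k → 0ℚ < - cross p j k) ⊎
     (∀ j k → 0ℚ < u p j → 0ℚ < - u p k → 0ℚ < cross p j k))

  X Y : Fin n → ℚ
  X j = y j + δ * x j
  Y j = δ * y j - x j

  v : Fin n → Fin n → ℚ
  v p j = δ * (y j - y p) - (x j - x p)

  u≡ΔX : ∀ p j → u p j ≡ X j - X p
  u≡ΔX p j = eq δ (x j) (y j) (x p) (y p)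
    where
    eq : ∀ δ xj yj xp yp → (yj - yp) + δ * (xj - xp) ≡ (yj + δ * xj) - (yp + δ * xp)
    eq = solve 5 (λ δ xj yj xp yp → (yj :- yp) :+ δ :* (xj :- xp) := (yj :+ δ :* xj) :- (yp :+ δ :* xp)) refl

  v≡ΔY : ∀ p j → v p j ≡ Y j - Y p
  v≡ΔY p j = eq δ (x j) (y j) (x p) (y p)
    where
    eq : ∀ δ xj yj xp yp → δ * (yj - yp) - (xj - xp) ≡ (δ * yj - xj) - (δ * yp - xp)
    eq = solve 5 (λ δ xj yj xp yp → δ :* (yj :- yp) :- (xj :- xp) := (δ :* yj :- xj) :- (δ :* yp :- xp)) refl

  0<1+δ² : 0ℚ < 1ℚ + δ * δ
  0<1+δ² = pos+nonneg (positive⁻¹ 1ℚ) (square-nonneg δ)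

  -- The linear map to the coordinates `u` and `v` has determinant `1 + δ * δ`.
  cross-rotated : ∀ p j k → (1ℚ + δ * δ) * - cross p j k ≡ u p k * v p j - u p j * v p k
  cross-rotated p j k = eq δ (x j - x p) (y j - y p) (x k - x p) (y k - y p)
    where
    eq : ∀ δ a b c d → (1ℚ + δ * δ) * - (a * d - c * b) ≡ (d + δ * c) * (δ * b - a) - (b + δ * a) * (δ * d - c)
    eq = solve 5 (λ δ a b c d → (con 1ℚ :+ δ :* δ) :* :- (a :* d :- c :* b) :=
      (d :+ δ :* c) :* (δ :* b :- a) :- (b :+ δ :* a) :* (δ :* d :- c)) refl

  supporting-line : ∀ p → OnHull p →
    ∃₂ λ b t → ∀ j → j ≢ p → 0ℚ < sign b * (t * (X j - X p) - (Y j - Y p))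
  supporting-line p (u≢0 , inj₁ clockwise) = true , t , λ j j≢p →
    subst₂ (λ a b → 0ℚ < 1ℚ * (t * a - b)) (u≡ΔX p j) (v≡ΔY p j)
      (subst (0ℚ <_) (sym (*-identityˡ (t * u p j - v p j))) (proj₂ line j (u≢0 j j≢p)))
    where
    line = supporting-slope (u p) (v p) (λ j k 0<u 0<-u →
      subst (0ℚ <_) (cross-rotated p j k) (pos*pos 0<1+δ² (clockwise j k 0<u 0<-u)))
    t = proj₁ line
  -- Reflecting `v` to `- v` reverses orientations, so the slope found for the mirror image is
  -- negated.
  supporting-line p (u≢0 , inj₂ counterclockwise) = false , - t , λ j j≢p →
    subst₂ (λ a b → 0ℚ < - 1ℚ * (- t * a - b)) (u≡ΔX p j) (v≡ΔY p j)
      (subst (0ℚ <_) (eq t (u p j) (v p j)) (proj₂ line j (u≢0 j j≢p)))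
    where
    turn : ∀ e c a b f g → e * - c ≡ a * f - b * g → e * c ≡ a * - f - b * - g
    turn e c a b f g h = trans (eq₁ e c) (trans (cong -_ h) (eq₂ a b f g))
      where
      eq₁ : ∀ e c → e * c ≡ - (e * - c)
      eq₁ = solve 2 (λ e c → e :* c := :- (e :* :- c)) refl
      eq₂ : ∀ a b f g → - (a * f - b * g) ≡ a * - f - b * - g
      eq₂ = solve 4 (λ a b f g → :- (a :* f :- b :* g) := a :* :- f :- b :* :- g) refl
    line = supporting-slope (u p) (λ j → - v p j) (λ j k 0<u 0<-u →
      subst (0ℚ <_) (turn (1ℚ + δ * δ) (cross p j k) (u p k) (u p j) (v p j) (v p k) (cross-rotated p j k))
        (pos*pos 0<1+δ² (counterclockwise j k 0<u 0<-u)))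
    t = proj₁ line
    eq : ∀ t u v → t * u - - v ≡ - 1ℚ * (- t * u - v)
    eq = solve 3 (λ t u v → t :* u :- :- v := con (- 1ℚ) :* (:- t :* u :- v)) refl

  rotated-dot : ∀ o p q → 0ℚ < (x p - x o) * (x q - x o) + (y p - y o) * (y q - y o) →
    0ℚ < (X p - X o) * (X q - X o) + (Y p - Y o) * (Y q - Y o)
  rotated-dot o p q 0<d = subst (0ℚ <_)
    (trans (eq δ (x p - x o) (y p - y o) (x q - x o) (y q - y o))
      (cong₂ _+_ (cong₂ _*_ (u≡ΔX o p) (u≡ΔX o q)) (cong₂ _*_ (v≡ΔY o p) (v≡ΔY o q))))
    (pos*pos 0<1+δ² 0<d)
    where
    eq : ∀ δ a b c d → (1ℚ + δ * δ) * (a * c + b * d) ≡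
      (b + δ * a) * (d + δ * c) + (δ * b - a) * (δ * d - c)
    eq = solve 5 (λ δ a b c d → (con 1ℚ :+ δ :* δ) :* (a :* c :+ b :* d) :=
      (b :+ δ :* a) :* (d :+ δ :* c) :+ (δ :* b :- a) :* (δ :* d :- c)) refl

-- Real numbers

Eventually : (ℕ → Set) → Set
Eventually φ = ∃ λ N → ∀ n → N ℕ.≤ n → φ n

eventually-map : ∀ {φ ψ} → (∀ n → φ n → ψ n) → Eventually φ → Eventually ψ
eventually-map f (N , h) = N , λ n N≤n → f n (h n N≤n)

eventually-zip : ∀ {φ ψ χ} → (∀ n → φ n → ψ n → χ n) → Eventually φ → Eventually ψ → Eventually χ
eventually-zip f (M , g) (N , h) = M ⊔ N , λ n MN≤n →
  f n (g n (ℕ.m⊔n≤o⇒m≤o M N MN≤n)) (h n (ℕ.m⊔n≤o⇒n≤o M N MN≤n))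

eventually-∀ : ∀ {m} {φ : Fin m → ℕ → Set} → (∀ i → Eventually (φ i)) → Eventually (λ n → ∀ i → φ i n)
eventually-∀ {zero}  h = 0 , λ _ _ ()
eventually-∀ {suc m} h = eventually-zip (λ _ a b → λ {zero → a; (suc i) → b i}) (h zero) (eventually-∀ (λ i → h (suc i)))

eventually⇒∃ : ∀ {φ} → Eventually φ → ∃ φ
eventually⇒∃ (N , h) = N , h N ℕ.≤-refl

-- `Pos` asks for a fixed rational margin: terms that are merely positive could tend to zero.
Pos Null : ℝ → Set
Pos x  = ∃ λ ε → 0ℚ < ε × Eventually (λ n → ε < seq x n)
Null x = ∀ ε → 0ℚ < ε → Eventually (λ n → ∣ seq x n ∣ < ε)

pos⇒eventually : ∀ x → Pos x → Eventually (λ n → 0ℚ < seq x n)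
pos⇒eventually x (ε , 0<ε , h) = eventually-map (λ _ → <-trans 0<ε) h

pos-resp : ∀ x y → (∀ n → seq x n ≡ seq y n) → Pos x → Pos y
pos-resp x y eq (ε , 0<ε , h) = ε , 0<ε , eventually-map (λ n → subst (ε <_) (eq n)) h

null-resp : ∀ x y → (∀ n → seq x n ≡ seq y n) → Null x → Null y
null-resp x y eq h ε 0<ε = eventually-map (λ n → subst (λ q → ∣ q ∣ < ε) (eq n)) (h ε 0<ε)

pos-+ : ∀ x y → Pos x → Pos y → Pos (x +ℝ y)
pos-+ x y (ε , 0<ε , h) (η , 0<η , k) = ε + η , pos+pos 0<ε 0<η , eventually-zip (λ _ → +-mono-<) h k

pos-* : ∀ x y → Pos x → Pos y → Pos (x *ℝ y)
pos-* x y (ε , 0<ε , h) (η , 0<η , k) = ε * η , pos*pos 0<ε 0<η , eventually-zip (λ n a b →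
  <-trans (*-monoʳ-<-pos ε {{positive 0<ε}} b) (*-monoˡ-<-pos (seq y n) {{positive (<-trans 0<η b)}} a)) h k

∣p∣<ε : ∀ {p ε} → p < ε → - p < ε → ∣ p ∣ < ε
∣p∣<ε {p} p<ε -p<ε with ∣p∣≡p∨∣p∣≡-p p
... | inj₁ e = subst (_< _) (sym e) p<ε
... | inj₂ e = subst (_< _) (sym e) -p<ε

p≤∣p∣ : ∀ p → p ≤ ∣ p ∣
p≤∣p∣ p with ≤-total 0ℚ p
... | inj₁ 0≤p = ≤-reflexive (sym (0≤p⇒∣p∣≡p 0≤p))
... | inj₂ p≤0 = ≤-trans p≤0 (0≤∣p∣ p)

-p≤∣p∣ : ∀ p → - p ≤ ∣ p ∣
-p≤∣p∣ p = subst (- p ≤_) (∣-p∣≡∣p∣ p) (p≤∣p∣ (- p))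

ε-ε/2 : ∀ ε → ε - ε * ½ ≡ ε * ½
ε-ε/2 ε = trans (cong (_- ε * ½) (sym (ε/2+ε/2 ε))) (half (ε * ½))
  where
  half : ∀ h → h + h - h ≡ h
  half = solve 1 (λ h → h :+ h :- h := h) refl

cauchy-pos : ∀ x N ε → 0ℚ < ε → (∀ m n → N ℕ.≤ m → N ℕ.≤ n → ∣ seq x m - seq x n ∣ < ε * ½) →
  ∀ n → N ℕ.≤ n → ε ≤ seq x n → Pos x
cauchy-pos x N ε 0<ε close n N≤n ε≤xn = ε * ½ , half-pos 0<ε , N , λ m N≤m →
  0<-⇒< (subst (0ℚ <_) (trans (eq (seq x n) (seq x m) (ε * ½) ε) (cong (λ q → seq x m - q) (ε-ε/2 ε)))
    (pos+nonneg (<⇒0<- (≤-<-trans (p≤∣p∣ _) (close n m N≤n N≤m))) (≤⇒0≤- ε≤xn)))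
  where
  eq : ∀ xn xm h ε → (h - (xn - xm)) + (xn - ε) ≡ xm - (ε - h)
  eq = solve 4 (λ xn xm h ε → (h :- (xn :- xm)) :+ (xn :- ε) := xm :- (ε :- h)) refl

-- A late term at distance `ε` or more from zero would fix the sign of `x`, since the terms after it
-- move by less than `ε * ½`.
trichotomy : ∀ x → ¬ Pos x → ¬ Pos (-ℝ x) → Null x
trichotomy x ¬pos ¬neg ε 0<ε =
  let (M , p) = cauchy x (ε * ½) (half-pos 0<ε)
      (N , q) = cauchy (-ℝ x) (ε * ½) (half-pos 0<ε)
  in M ⊔ N , λ n h → ∣p∣<ε
    (≰⇒> λ ε≤ → ¬pos (cauchy-pos x M ε 0<ε p n (ℕ.m⊔n≤o⇒m≤o M N h) ε≤))
    (≰⇒> λ ε≤ → ¬neg (cauchy-pos (-ℝ x) N ε 0<ε q n (ℕ.m⊔n≤o⇒n≤o M N h) ε≤))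

null-* : ∀ x y → Null y → Null (x *ℝ y)
null-* x y h ε 0<ε =
  let (B , 0<B , bounded) = cauchy⇒bounded (seq x) (cauchy x)
      (δ , 0<δ , Bδ≡ε)    = scale 0<B 0<ε
  in eventually-zip
    (λ n b s → subst (∣ seq x n * seq y n ∣ <_) Bδ≡ε (∣u*v∣<Cγ 0<B (seq x n) (seq y n) b s)) bounded (h δ 0<δ)

null-neg : ∀ x → Null x → Null (-ℝ x)
null-neg x h ε 0<ε = eventually-map (λ n → subst (_< ε) (sym (∣-p∣≡∣p∣ (seq x n)))) (h ε 0<ε)

pos-null-+ : ∀ x y → Null x → Pos y → Pos (x +ℝ y)
pos-null-+ x y h (ε , 0<ε , k) = ε * ½ , half-pos 0<ε , eventually-zip (λ n a b →
  0<-⇒< (subst (0ℚ <_)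
    (trans (eq (seq x n) (seq y n) (ε * ½) ε) (cong (λ e → seq x n + seq y n - e) (ε-ε/2 ε)))
    (pos+pos (<⇒0<- (≤-<-trans (-p≤∣p∣ (seq x n)) a)) (<⇒0<- b)))) (h (ε * ½) (half-pos 0<ε)) k
  where
  eq : ∀ x y h ε → (h - - x) + (y - ε) ≡ x + y - (ε - h)
  eq = solve 4 (λ x y h ε → (h :- :- x) :+ (y :- ε) := x :+ y :- (ε :- h)) refl

-- The value at q ≤ 0 is the junk value 0.
recip : ℚ → ℚ
recip q with 0ℚ <? q
... | yes 0<q = (1/ q) {{pos⇒nonZero q {{positive 0<q}}}}
... | no  _   = 0ℚ

recip-nonneg : ∀ q → 0ℚ ≤ recip q
recip-nonneg q with 0ℚ <? q
... | yes 0<q = <⇒≤ (positive⁻¹ _ {{1/pos⇒pos q {{positive 0<q}}}})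
... | no  _   = ≤-refl

recip-inverse : ∀ q → 0ℚ < q → recip q * q ≡ 1ℚ
recip-inverse q 0<q with 0ℚ <? q
... | yes 0<q′ = *-inverseˡ q {{pos⇒nonZero q {{positive 0<q′}}}}
... | no  0≮q  = ⊥-elim (0≮q 0<q)

recip-anti : ∀ ε q → 0ℚ < ε → ε ≤ q → recip q ≤ recip ε
recip-anti ε q 0<ε ε≤q = subst₂ _≤_
  (trans (cong (recip q *_) (trans (*-comm ε (recip ε)) (recip-inverse ε 0<ε))) (*-identityʳ (recip q)))
  (trans (sym (*-assoc (recip q) q (recip ε)))
    (trans (cong (_* recip ε) (recip-inverse q (<-≤-trans 0<ε ε≤q))) (*-identityˡ (recip ε))))
  (*-monoˡ-≤-nonNeg (recip q) {{nonNegative (recip-nonneg q)}}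
    (*-monoʳ-≤-nonNeg (recip ε) {{nonNegative (recip-nonneg ε)}} ε≤q))

recip-difference : ∀ a b → 0ℚ < a → 0ℚ < b → recip a - recip b ≡ (recip a * recip b) * (b - a)
recip-difference a b 0<a 0<b = sym (trans (eq (recip a) (recip b) a b)
  (cong₂ _-_ (trans (cong (recip a *_) (recip-inverse b 0<b)) (*-identityʳ (recip a)))
             (trans (cong (recip b *_) (recip-inverse a 0<a)) (*-identityʳ (recip b)))))
  where
  eq : ∀ r s a b → (r * s) * (b - a) ≡ r * (s * b) - s * (r * a)
  eq = solve 4 (λ r s a b → (r :* s) :* (b :- a) := r :* (s :* b) :- s :* (r :* a)) refl

-- Late terms exceed `ε`, so their reciprocals are at most `recip ε`, and reciprocals differ by at
-- most the square of that bound times the difference of the terms.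
recip-cauchy : ∀ x → Pos x → IsCauchy (λ n → recip (seq x n))
recip-cauchy x (ε , 0<ε , M , above) η 0<η =
  let i            = recip ε
      0<i          = pos-recip
      (γ , 0<γ , iiγ≡η) = scale (pos*pos 0<i 0<i) 0<η
      (N , close)  = cauchy x γ 0<γ
  in M ⊔ N , λ m n h k →
    let εm = above m (ℕ.m⊔n≤o⇒m≤o M N h)
        εn = above n (ℕ.m⊔n≤o⇒m≤o M N k)
    in subst₂ (λ a b → ∣ a ∣ < b) (sym (recip-difference (seq x m) (seq x n) (<-trans 0<ε εm) (<-trans 0<ε εn))) iiγ≡η
      (∣u*v∣<Cγ (pos*pos 0<i 0<i) (recip (seq x m) * recip (seq x n)) (seq x n - seq x m)
        (subst (_≤ i * i) (sym (0≤p⇒∣p∣≡p (nonneg*nonneg (recip-nonneg (seq x m)) (recip-nonneg (seq x n)))))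
          (≤-trans (*-monoˡ-≤-nonNeg (recip (seq x m)) {{nonNegative (recip-nonneg (seq x m))}}
                      (recip-anti ε (seq x n) 0<ε (<⇒≤ εn)))
                   (*-monoʳ-≤-nonNeg i {{nonNegative (recip-nonneg ε)}} (recip-anti ε (seq x m) 0<ε (<⇒≤ εm)))))
        (close n m (ℕ.m⊔n≤o⇒n≤o M N k) (ℕ.m⊔n≤o⇒n≤o M N h)))
  where
  pos-recip : 0ℚ < recip ε
  pos-recip = ≰⇒> λ r≤0 → <-irrefl refl (<-≤-trans (positive⁻¹ 1ℚ)
    (subst₂ _≤_ (recip-inverse ε 0<ε) (*-zeroˡ ε) (*-monoʳ-≤-nonNeg ε {{nonNegative (<⇒≤ 0<ε)}} r≤0)))

recipℝ : ∀ x → Pos x → ℝ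
recipℝ x pos = mkℝ (λ n → recip (seq x n)) (recip-cauchy x pos)

-- Convex combinations

sum-scale : ∀ {m} (w : Fin m → ℝ) r n → seq (sumℝ (λ k → w k *ℝ r)) n ≡ seq r n * seq (sumℝ w) n
sum-scale {zero}  w r n = sym (*-zeroʳ (seq r n))
sum-scale {suc m} w r n = trans (cong (seq (w zero) n * seq r n +_) (sum-scale (λ k → w (suc k)) r n))
  (eq (seq (w zero) n) (seq r n) (seq (sumℝ (λ k → w (suc k))) n))
  where
  eq : ∀ w r s → w * r + r * s ≡ r * (w + s)
  eq = solve 3 (λ w r s → w :* r :+ r :* s := r :* (w :+ s)) refl

sum-affine : ∀ {m} (w z : Fin m → ℝ) z₀ r n → seq (sumℝ (λ k → (w k *ℝ r) *ℝ z k)) n ≡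
  seq r n * (seq (sumℝ (λ k → w k *ℝ (z k -ℝ z₀))) n + seq (sumℝ w) n * seq z₀ n)
sum-affine {zero}  w z z₀ r n = eq (seq r n) (seq z₀ n)
  where
  eq : ∀ r z → 0ℚ ≡ r * (0ℚ + 0ℚ * z)
  eq = solve 2 (λ r z → con 0ℚ := r :* (con 0ℚ :+ con 0ℚ :* z)) refl
sum-affine {suc m} w z z₀ r n = trans
  (cong (seq (w zero) n * seq r n * seq (z zero) n +_) (sum-affine (λ k → w (suc k)) (λ k → z (suc k)) z₀ r n))
  (eq (seq (w zero) n) (seq (z zero) n) (seq r n) (seq z₀ n) (seq (sumℝ (λ k → w (suc k) *ℝ (z (suc k) -ℝ z₀))) n)
      (seq (sumℝ (λ k → w (suc k))) n))
  where
  eq : ∀ w z r z₀ d s → w * r * z + r * (d + s * z₀) ≡ r * (w * (z - z₀) + d + (w + s) * z₀)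
  eq = solve 6 (λ w z r z₀ d s →
    w :* r :* z :+ r :* (d :+ s :* z₀) := r :* (w :* (z :- z₀) :+ d :+ (w :+ s) :* z₀)) refl

-- Once the total weight is positive, the mean differs from `z₀` by exactly its reciprocal times the
-- null sum of weighted deviations.
weighted-mean : ∀ {m} (w : Fin m → ℝ) (pos : Pos (sumℝ w)) (z : Fin m → ℝ) z₀ →
  Null (sumℝ (λ k → w k *ℝ (z k -ℝ z₀))) → sumℝ (λ k → (w k *ℝ recipℝ (sumℝ w) pos) *ℝ z k) ≈ z₀
weighted-mean w pos z z₀ null ε 0<ε = eventually-zip
  (λ n 0<W small → subst (λ q → ∣ q ∣ < ε) (sym (mean n 0<W)) small)
  (pos⇒eventually (sumℝ w) pos) (null-* (recipℝ (sumℝ w) pos) (sumℝ (λ k → w k *ℝ (z k -ℝ z₀))) null ε 0<ε)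
  where
  W : ℕ → ℚ
  W = seq (sumℝ w)
  D : ℕ → ℚ
  D = seq (sumℝ (λ k → w k *ℝ (z k -ℝ z₀)))
  eq : ∀ r d W z → r * (d + W * z) - z ≡ r * d + (r * W - 1ℚ) * z
  eq = solve 4 (λ r d W z → r :* (d :+ W :* z) :- z := r :* d :+ (r :* W :- con 1ℚ) :* z) refl
  eq′ : ∀ q z → q + (1ℚ - 1ℚ) * z ≡ q
  eq′ = solve 2 (λ q z → q :+ (con 1ℚ :- con 1ℚ) :* z := q) refl
  mean : ∀ n → 0ℚ < W n →
    seq (sumℝ (λ k → (w k *ℝ recipℝ (sumℝ w) pos) *ℝ z k)) n - seq z₀ n ≡ recip (W n) * D n
  mean n 0<W = trans (cong (_- seq z₀ n) (sum-affine w z z₀ (recipℝ (sumℝ w) pos) n))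
    (trans (eq (recip (W n)) (D n) (W n) (seq z₀ n))
      (trans (cong (λ o → recip (W n) * D n + (o - 1ℚ) * seq z₀ n) (recip-inverse (W n) 0<W))
        (eq′ (recip (W n) * D n) (seq z₀ n))))

≈-refl : ∀ x → x ≈ x
≈-refl x ε 0<ε = 0 , λ n _ → subst (λ z → ∣ z ∣ < ε) (sym (+-inverseʳ (seq x n))) 0<ε

normalized-nonneg : ∀ w W (pos : Pos W) → Pos w → 0ℝ ≤ℝ w *ℝ recipℝ W pos
normalized-nonneg w W pos 0<w (ε , 0<ε , c<0) =
  let (n , c+ε<0 , 0<wn) = eventually⇒∃ (eventually-zip (λ _ → _,_) c<0 (pos⇒eventually w 0<w))
  in <-irrefl refl (<-trans (nonneg+pos (nonneg*nonneg (<⇒≤ 0<wn) (recip-nonneg (seq W n))) 0<ε) c+ε<0)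

normalized-sum : ∀ {m} (w : Fin m → ℝ) (pos : Pos (sumℝ w)) → sumℝ (λ k → w k *ℝ recipℝ (sumℝ w) pos) ≈ 1ℝ
normalized-sum w pos ε 0<ε = eventually-map
  (λ n 0<W → subst (λ q → ∣ q - 1ℚ ∣ < ε)
    (sym (trans (sum-scale w (recipℝ (sumℝ w) pos) n) (recip-inverse (seq (sumℝ w) n) 0<W))) 0<ε)
  (pos⇒eventually (sumℝ w) pos)

-- Dividing by the total weight would exhibit `P p` as a convex combination of other points.
-- Unnormalised weights can be polynomials in the coordinates, and `idx` may repeat an index.
no-convex-combination : ∀ {n} (P : Fin n → Point) → ConvexlyIndependent P →
  ∀ p {m} (idx : Fin m → Fin n) → (∀ k → idx k ≢ p) →
  (w : Fin m → ℝ) → (∀ k → Pos (w k)) → Pos (sumℝ w) →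
  Null (sumℝ (λ k → w k *ℝ (proj₁ (P (idx k)) -ℝ proj₁ (P p)))) →
  Null (sumℝ (λ k → w k *ℝ (proj₂ (P (idx k)) -ℝ proj₂ (P p)))) → ⊥
no-convex-combination P ci p {m} idx idx≢p w 0<w 0<W nullx nully = ci p
  ( m , (λ k → P (idx k)) , (λ k → w k *ℝ recipℝ (sumℝ w) 0<W)
  , (λ k → idx k , idx≢p k , ≈-refl (proj₁ (P (idx k))) , ≈-refl (proj₂ (P (idx k))))
  , (λ k → normalized-nonneg (w k) (sumℝ w) 0<W (0<w k))
  , normalized-sum w 0<W
  , weighted-mean w 0<W (λ k → proj₁ (P (idx k))) (proj₁ (P p)) nullx
  , weighted-mean w 0<W (λ k → proj₂ (P (idx k))) (proj₂ (P p)) nully )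

-- Classical reasoning over finite sets and a generic direction.

¬¬-∀ : ∀ {m} {φ : Fin m → Set} → (∀ i → ¬ ¬ φ i) → ¬ ¬ (∀ i → φ i)
¬¬-∀ {zero}  h k = k λ ()
¬¬-∀ {suc m} h k = h zero λ a → ¬¬-∀ (λ i → h (suc i)) λ b → k λ {zero → a; (suc i) → b i}

-- Finiteness enters twice: double negation passes through a finite quantifier, and finitely many
-- thresholds have a common bound.
¬¬-eventually-∀ : ∀ {m} {φ : Fin m → ℕ → Set} → (∀ i → ¬ ¬ Eventually (φ i)) → ¬ ¬ Eventually (λ n → ∀ i → φ i n)
¬¬-eventually-∀ h k = ¬¬-∀ h λ g → k (eventually-∀ g)

always : ∀ {φ : ℕ → Set} → (∀ n → φ n) → Eventually φ
always h = 0 , λ n _ → h n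

frac-pos : ∀ q → 0ℚ < frac 1 q
frac-pos q = positive⁻¹ (frac 1 q) {{normalize-pos 1 (suc q)}}

-- For all large q the functional y + x / (q + 1) takes distinct values at distinct points.
tilt : ℕ → ℝ → ℝ → ℝ
tilt q a b = a +ℝ fromℚ (frac 1 q) *ℝ b

tilt-pos : ∀ a b → Pos a → Eventually (λ q → Pos (tilt q a b))
tilt-pos a b (ε , 0<ε , a>ε) =
  let (B , 0<B , bounded) = cauchy⇒bounded (seq b) (cauchy b)
      (γ , 0<γ , Bγ≡ε/2)  = scale 0<B (half-pos 0<ε)
  in eventually-map (λ q frac<γ → ε * ½ , half-pos 0<ε , eventually-zip (λ n ε<a b≤B →
       0<-⇒< (subst (0ℚ <_)
         (trans (eq (seq a n) (frac 1 q * seq b n) (ε * ½) ε) (cong (λ e → seq a n + frac 1 q * seq b n - e) (ε-ε/2 ε)))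
         (pos+pos (<⇒0<- ε<a) (<⇒0<- (≤-<-trans (-p≤∣p∣ (frac 1 q * seq b n))
           (subst₂ _<_ (cong ∣_∣ (*-comm (seq b n) (frac 1 q))) Bγ≡ε/2
             (∣u*v∣<Cγ 0<B (seq b n) (frac 1 q) b≤B
               (subst (_< γ) (sym (0≤p⇒∣p∣≡p (<⇒≤ (frac-pos q)))) frac<γ))))))))
       a>ε bounded) (archimedean γ 0<γ)
  where
  eq : ∀ a b h ε → (a - ε) + (h - - b) ≡ a + b - (ε - h)
  eq = solve 4 (λ a b h ε → (a :- ε) :+ (h :- :- b) := a :+ b :- (ε :- h)) refl

tilt-pos₀ : ∀ a b → Null a → Pos b → ∀ q → Pos (tilt q a b)
tilt-pos₀ a b a≈0 0<b q = pos-null-+ a (fromℚ δ *ℝ b) a≈0 (pos-* (fromℚ δ) b posδ 0<b)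
  where
  δ = frac 1 q
  posδ : Pos (fromℚ δ)
  posδ = let (m , 0<m , m<δ) = <-dense (frac-pos q) in m , 0<m , always (λ _ → m<δ)

Apart : ℝ → Set
Apart x = Pos x ⊎ Pos (-ℝ x)

tilt-neg : ∀ q a b → Pos (tilt q (-ℝ a) (-ℝ b)) → Pos (-ℝ tilt q a b)
tilt-neg q a b = pos-resp (tilt q (-ℝ a) (-ℝ b)) (-ℝ tilt q a b) λ n → eq (seq a n) (seq b n) (frac 1 q)
  where
  eq : ∀ a b δ → - a + δ * - b ≡ - (a + δ * b)
  eq = solve 3 (λ a b δ → :- a :+ δ :* :- b := :- (a :+ δ :* b)) refl

-- The sign is lexicographic: a nonzero `a` decides it for all large `q`, and when `a` is null the
-- sign of `b` decides it for every `q`.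
tilt-apart : ∀ a b → ¬ (Null a × Null b) → ¬ ¬ Eventually (λ q → Apart (tilt q a b))
tilt-apart a b ¬null k =
  ¬¬-excluded-middle λ
    { (yes a>0) → k (eventually-map (λ _ → inj₁) (tilt-pos a b a>0))
    ; (no a≯0) → ¬¬-excluded-middle λ
      { (yes a<0) → k (eventually-map (λ q h → inj₂ (tilt-neg q a b h)) (tilt-pos (-ℝ a) (-ℝ b) a<0))
      ; (no a≮0) → ¬¬-excluded-middle λ
        { (yes b>0) → k (always λ q → inj₁ (tilt-pos₀ a b (trichotomy a a≯0 a≮0) b>0 q))
        ; (no b≯0) → ¬¬-excluded-middle λ
          { (yes b<0) → k (always λ q → inj₂ (tilt-neg q a b
                          (tilt-pos₀ (-ℝ a) (-ℝ b) (null-neg a (trichotomy a a≯0 a≮0)) b<0 q)))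
          ; (no b≮0) → ¬null (trichotomy a a≯0 a≮0 , trichotomy b b≯0 b≮0) } } } }

null-0 : ∀ x → (∀ n → seq x n ≡ 0ℚ) → Null x
null-0 x eq ε 0<ε = always λ n → subst (λ q → ∣ q ∣ < ε) (sym (eq n)) 0<ε

-- Orientations around a point of a convexly independent set.

module ConvexPosition {n} (P : Fin n → Point) (ci : ConvexlyIndependent P) (q : ℕ) where

  δ = frac 1 q

  dx dy u : Fin n → Fin n → ℝ
  dx p j = proj₁ (P j) -ℝ proj₁ (P p)
  dy p j = proj₂ (P j) -ℝ proj₂ (P p)
  u p j = tilt q (dy p j) (dx p j)

  cross : Fin n → Fin n → Fin n → ℝ
  cross p j k = dx p j *ℝ dy p k -ℝ dx p k *ℝ dy p j

  u-self : ∀ p m → seq (u p p) m ≡ 0ℚ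
  u-self p m = eq (seq (proj₁ (P p)) m) (seq (proj₂ (P p)) m) δ
    where
    eq : ∀ x y δ → (y - y) + δ * (x - x) ≡ 0ℚ
    eq = solve 3 (λ x y δ → (y :- y) :+ δ :* (x :- x) := con 0ℚ) refl

  pos-u⇒≢ : ∀ {p j} → Pos (u p j) → j ≢ p
  pos-u⇒≢ {p} h refl = let (m , 0<u) = eventually⇒∃ (pos⇒eventually (u p p) h) in pos≢0 0<u (u-self p m)

  neg-u⇒≢ : ∀ {p j} → Pos (-ℝ u p j) → j ≢ p
  neg-u⇒≢ {p} h refl = let (m , 0<-u) = eventually⇒∃ (pos⇒eventually (-ℝ u p p) h) in
    neg≢0 0<-u (u-self p m)

  pair-x : ∀ p j k m → - seq (u p k) m * seq (dx p j) m + seq (u p j) m * seq (dx p k) m ≡ - seq (cross p j k) m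
  pair-x p j k m = eqx δ (seq (dx p j) m) (seq (dy p j) m) (seq (dx p k) m) (seq (dy p k) m)
    where
    eqx : ∀ δ a b c d → - (d + δ * c) * a + (b + δ * a) * c ≡ - (a * d - c * b)
    eqx = solve 5 (λ δ a b c d → :- (d :+ δ :* c) :* a :+ (b :+ δ :* a) :* c := :- (a :* d :- c :* b)) refl

  pair-y : ∀ p j k m → - seq (u p k) m * seq (dy p j) m + seq (u p j) m * seq (dy p k) m ≡ δ * seq (cross p j k) m
  pair-y p j k m = eqy δ (seq (dx p j) m) (seq (dy p j) m) (seq (dx p k) m) (seq (dy p k) m)
    where
    eqy : ∀ δ a b c d → - (d + δ * c) * b + (b + δ * a) * d ≡ δ * (a * d - c * b)
    eqy = solve 5 (λ δ a b c d → :- (d :+ δ :* c) :* b :+ (b :+ δ :* a) :* d := δ :* (a :* d :- c :* b)) refl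

  -- The combination (-u_k)·(P_j - P_p) + u_j·(P_k - P_p) equals cross·(-1 , δ), so it vanishes with cross.
  not-collinear : ∀ p j k → Pos (u p j) → Pos (-ℝ u p k) → ¬ Null (cross p j k)
  not-collinear p j k 0<uj uk<0 null = no-convex-combination P ci p idx
    (λ {zero → pos-u⇒≢ 0<uj; (suc zero) → neg-u⇒≢ uk<0})
    w (λ {zero → uk<0; (suc zero) → 0<uj})
    (pos-resp ((-ℝ u p k) +ℝ u p j) (sumℝ w)
      (λ m → cong (- seq (u p k) m +_) (sym (+-identityʳ (seq (u p j) m))))
      (pos-+ (-ℝ u p k) (u p j) uk<0 0<uj))
    (null-resp (-ℝ cross p j k) (sumℝ (λ i → w i *ℝ dx p (idx i)))
      (λ m → pad (- seq (u p k) m * seq (dx p j) m) (seq (u p j) m * seq (dx p k) m) (pair-x p j k m)) (null-neg (cross p j k) null))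
    (null-resp (fromℚ δ *ℝ cross p j k) (sumℝ (λ i → w i *ℝ dy p (idx i)))
      (λ m → pad (- seq (u p k) m * seq (dy p j) m) (seq (u p j) m * seq (dy p k) m) (pair-y p j k m)) (null-* (fromℚ δ) (cross p j k) null))
    where
    w = (-ℝ u p k) ∷ u p j ∷ []
    idx = j ∷ k ∷ []
    pad : ∀ a b {c} → a + b ≡ c → c ≡ a + (b + 0ℚ)
    pad a b eq = trans (sym eq) (cong (a +_) (sym (+-identityʳ b)))

  -- The pairs `j`, `k` and `j′`, `k′` give combinations equal to `cross` and `cross′` times
  -- `(-1 , δ)`. If these crosses had opposite signs, the positive weights `- cross′` and `cross`
  -- would cancel them and balance four points at `P p`.
  same-turn : ∀ p j k j′ k′ → Pos (u p j) → Pos (-ℝ u p k) → Pos (u p j′) → Pos (-ℝ u p k′) →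
    Pos (cross p j k) → ¬ Pos (-ℝ cross p j′ k′)
  same-turn p j k j′ k′ 0<uj uk<0 0<uj′ uk′<0 0<c c′<0 = no-convex-combination P ci p idx
    (λ { zero → pos-u⇒≢ 0<uj; (suc zero) → neg-u⇒≢ uk<0
       ; (suc (suc zero)) → pos-u⇒≢ 0<uj′; (suc (suc (suc zero))) → neg-u⇒≢ uk′<0 })
    w (λ {zero → 0<w₁; (suc zero) → 0<w₂; (suc (suc zero)) → 0<w₃; (suc (suc (suc zero))) → 0<w₄})
    (pos-resp (w₁ +ℝ (w₂ +ℝ (w₃ +ℝ w₄))) (sumℝ w)
      (λ m → cong (λ z → seq w₁ m + (seq w₂ m + (seq w₃ m + z))) (sym (+-identityʳ (seq w₄ m))))
      (pos-+ w₁ (w₂ +ℝ (w₃ +ℝ w₄)) 0<w₁ (pos-+ w₂ (w₃ +ℝ w₄) 0<w₂ (pos-+ w₃ w₄ 0<w₃ 0<w₄))))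
    (null-0 (sumℝ (λ i → w i *ℝ dx p (idx i))) λ m → trans
      (eq (seq (cross p j′ k′) m) (seq (u p k) m) (seq (u p j) m) (seq (cross p j k) m) (seq (u p k′) m) (seq (u p j′) m)
        (seq (dx p j) m) (seq (dx p k) m) (seq (dx p j′) m) (seq (dx p k′) m))
      (trans (cong₂ (λ a b → - seq (cross p j′ k′) m * a + seq (cross p j k) m * b) (pair-x p j k m) (pair-x p j′ k′ m))
        (cancel₁ (seq (cross p j k) m) (seq (cross p j′ k′) m))))
    (null-0 (sumℝ (λ i → w i *ℝ dy p (idx i))) λ m → trans
      (eq (seq (cross p j′ k′) m) (seq (u p k) m) (seq (u p j) m) (seq (cross p j k) m) (seq (u p k′) m) (seq (u p j′) m)
        (seq (dy p j) m) (seq (dy p k) m) (seq (dy p j′) m) (seq (dy p k′) m))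
      (trans (cong₂ (λ a b → - seq (cross p j′ k′) m * a + seq (cross p j k) m * b) (pair-y p j k m) (pair-y p j′ k′ m))
        (cancel₂ δ (seq (cross p j k) m) (seq (cross p j′ k′) m))))
    where
    w₁ = (-ℝ cross p j′ k′) *ℝ (-ℝ u p k)
    w₂ = (-ℝ cross p j′ k′) *ℝ u p j
    w₃ = cross p j k *ℝ (-ℝ u p k′)
    w₄ = cross p j k *ℝ u p j′
    w = w₁ ∷ w₂ ∷ w₃ ∷ w₄ ∷ []
    idx = j ∷ k ∷ j′ ∷ k′ ∷ []
    0<w₁ = pos-* (-ℝ cross p j′ k′) (-ℝ u p k) c′<0 uk<0
    0<w₂ = pos-* (-ℝ cross p j′ k′) (u p j) c′<0 0<uj
    0<w₃ = pos-* (cross p j k) (-ℝ u p k′) 0<c uk′<0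
    0<w₄ = pos-* (cross p j k) (u p j′) 0<c 0<uj′
    eq : ∀ c′ uk uj c uk′ uj′ a b a′ b′ →
      - c′ * - uk * a + (- c′ * uj * b + (c * - uk′ * a′ + (c * uj′ * b′ + 0ℚ))) ≡
      - c′ * (- uk * a + uj * b) + c * (- uk′ * a′ + uj′ * b′)
    eq = solve 10 (λ c′ uk uj c uk′ uj′ a b a′ b′ →
      :- c′ :* :- uk :* a :+ (:- c′ :* uj :* b :+ (c :* :- uk′ :* a′ :+ (c :* uj′ :* b′ :+ con 0ℚ))) :=
      :- c′ :* (:- uk :* a :+ uj :* b) :+ c :* (:- uk′ :* a′ :+ uj′ :* b′)) refl
    cancel₁ : ∀ c c′ → - c′ * - c + c * - c′ ≡ 0ℚ
    cancel₁ = solve 2 (λ c c′ → :- c′ :* :- c :+ c :* :- c′ := con 0ℚ) refl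
    cancel₂ : ∀ δ c c′ → - c′ * (δ * c) + c * (δ * c′) ≡ 0ℚ
    cancel₂ = solve 3 (λ δ c c′ → :- c′ :* (δ :* c) :+ c :* (δ :* c′) := con 0ℚ) refl

  module _ (apart : ∀ p j → j ≢ p → Apart (u p j)) where

    apart-elim : ∀ p j {A : Set} → (j ≡ p → A) → (Pos (u p j) → A) → (Pos (-ℝ u p j) → A) → A
    apart-elim p j {A} f g h = cases (j Fin.≟ p)
      where
      cases : Dec (j ≡ p) → A
      cases (yes j≡p) = f j≡p
      cases (no j≢p)  = [ g , h ]′ (apart p j j≢p)

    pos∧neg⇒⊥ : ∀ {r} → 0ℚ < r → ¬ 0ℚ < - r
    pos∧neg⇒⊥ {r} 0<r 0<-r = pos≢0 (pos+pos 0<r 0<-r) (+-inverseʳ r)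

    u-self′ : ∀ {p j} → j ≡ p → ∀ m → seq (u p j) m ≡ 0ℚ
    u-self′ {p} refl = u-self p

    ¬pos⇒eventually : ∀ p j → ¬ Pos (u p j) → Eventually (λ m → ¬ 0ℚ < seq (u p j) m)
    ¬pos⇒eventually p j u≯0 = apart-elim p j
      (λ j≡p → always λ m 0<u → pos≢0 0<u (u-self′ j≡p m))
      (λ u>0 → ⊥-elim (u≯0 u>0))
      (λ u<0 → eventually-map (λ m 0<-u 0<u → pos∧neg⇒⊥ 0<u 0<-u) (pos⇒eventually (-ℝ u p j) u<0))

    ¬neg⇒eventually : ∀ p j → ¬ Pos (-ℝ u p j) → Eventually (λ m → ¬ 0ℚ < - seq (u p j) m)
    ¬neg⇒eventually p j u≮0 = apart-elim p j
      (λ j≡p → always λ m 0<-u → neg≢0 0<-u (u-self′ j≡p m))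
      (λ u>0 → eventually-map (λ m → pos∧neg⇒⊥) (pos⇒eventually (u p j) u>0))
      (λ u<0 → ⊥-elim (u≮0 u<0))

    -- By `apart`, late approximations show the true sign of each `u`, so when a premise fails over
    -- the reals it also fails in late approximations.
    turn-eventually : ∀ p j k z → (Pos (u p j) → Pos (-ℝ u p k) → ¬ ¬ Pos z) →
      ¬ ¬ Eventually (λ m → 0ℚ < seq (u p j) m → 0ℚ < - seq (u p k) m → 0ℚ < seq z m)
    turn-eventually p j k z h ¬ev = ¬¬-excluded-middle λ
      { (no u≯0) → ¬ev (eventually-map (λ _ u≯0 0<u → ⊥-elim (u≯0 0<u)) (¬pos⇒eventually p j u≯0))
      ; (yes u>0) → ¬¬-excluded-middle λ
        { (no u≮0) → ¬ev (eventually-map (λ _ u≮0 _ 0<-u → ⊥-elim (u≮0 0<-u)) (¬neg⇒eventually p k u≮0))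
        ; (yes u<0) → h u>0 u<0 λ z>0 → ¬ev (eventually-map (λ _ 0<z _ _ → 0<z) (pos⇒eventually z z>0)) } }

    apart⇒eventually : ∀ p j → Eventually (λ m → j ≢ p → seq (u p j) m ≢ 0ℚ)
    apart⇒eventually p j = apart-elim p j
      (λ j≡p → always λ _ j≢p → ⊥-elim (j≢p j≡p))
      (λ u>0 → eventually-map (λ _ 0<u _ → pos≢0 0<u) (pos⇒eventually (u p j) u>0))
      (λ u<0 → eventually-map (λ _ 0<-u _ → neg≢0 0<-u) (pos⇒eventually (-ℝ u p j) u<0))

    -- Classically, either some pair turns counterclockwise, and `same-turn` forbids clockwise
    -- pairs, or no pair does. In both cases `not-collinear` makes the remaining orientation strict.
    onHull : ∀ p → ¬ ¬ Eventually (λ m → Rotated.OnHull δ (λ j → seq (proj₁ (P j)) m) (λ j → seq (proj₂ (P j)) m) p)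
    onHull p ¬ev = ¬¬-excluded-middle
      {A = ∃₂ λ j k → Pos (u p j) × Pos (-ℝ u p k) × Pos (cross p j k)} λ
      { (yes (j , k , u>0 , u<0 , c>0)) →
          ¬¬-eventually-∀ (λ j′ → ¬¬-eventually-∀ λ k′ → turn-eventually p j′ k′ (cross p j′ k′) λ u′>0 u′<0 c′≯0 →
            not-collinear p j′ k′ u′>0 u′<0
              (trichotomy (cross p j′ k′) c′≯0 (same-turn p j k j′ k′ u>0 u<0 u′>0 u′<0 c>0)))
          λ turns → ¬ev (eventually-zip (λ _ a b → a , inj₂ b) (eventually-∀ (apart⇒eventually p)) turns)
      ; (no ∄) →
          ¬¬-eventually-∀ (λ j′ → ¬¬-eventually-∀ λ k′ → turn-eventually p j′ k′ (-ℝ cross p j′ k′) λ u′>0 u′<0 c′≮0 →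
            not-collinear p j′ k′ u′>0 u′<0
              (trichotomy (cross p j′ k′) (λ c′>0 → ∄ (j′ , k′ , u′>0 , u′<0 , c′>0)) c′≮0))
          λ turns → ¬ev (eventually-zip (λ _ a b → a , inj₁ b) (eventually-∀ (apart⇒eventually p)) turns)
      }

-- Transfer to the rationals

-- The power of `w` with respect to the circle with diameter `uv` is the dot product of `u - w` and
-- `v - w`, so outside the disk the angle at `w` is acute.
thales : ∀ (u v w : Point) m → seq (dist² u (midpoint u v)) m < seq (dist² w (midpoint u v)) m →
  0ℚ < (seq (proj₁ u) m - seq (proj₁ w) m) * (seq (proj₁ v) m - seq (proj₁ w) m) +
       (seq (proj₂ u) m - seq (proj₂ w) m) * (seq (proj₂ v) m - seq (proj₂ w) m)
thales (ux , uy) (vx , vy) (wx , wy) m closer =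
  subst (0ℚ <_) (trans (regroup (d ux ux vx) (d uy uy vy) (d wx ux vx) (d wy uy vy))
    (cong₂ _+_ (power (seq ux m) (seq vx m) (seq wx m)) (power (seq uy m) (seq vy m) (seq wy m)))) (<⇒0<- closer)
  where
  d : ℝ → ℝ → ℝ → ℚ
  d a u v = (seq a m - ½ * (seq u m + seq v m)) * (seq a m - ½ * (seq u m + seq v m))
  regroup : ∀ a b c d → (c + d) - (a + b) ≡ (c - a) + (d - b)
  regroup = solve 4 (λ a b c d → (c :+ d) :- (a :+ b) := (c :- a) :+ (d :- b)) refl
  power : ∀ u v w → (w - ½ * (u + v)) * (w - ½ * (u + v)) - (u - ½ * (u + v)) * (u - ½ * (u + v)) ≡ (u - w) * (v - w)
  power = solve 3 (λ u v w → (w :- con ½ :* (u :+ v)) :* (w :- con ½ :* (u :+ v)) :-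
    (u :- con ½ :* (u :+ v)) :* (u :- con ½ :* (u :+ v)) := (u :- w) :* (v :- w)) refl

module RationalApproximation {n} (P : Fin n → Point) (G : Graph n) where
  open Graph G

  x y : ℕ → Fin n → ℚ
  x m j = seq (proj₁ (P j)) m
  y m j = seq (proj₂ (P j)) m

  AcuteAt : ℕ → Set
  AcuteAt m = ∀ u v w → u ~ v → u ~ w → v ≢ w → 0ℚ < (x m u - x m v) * (x m w - x m v) + (y m u - y m v) * (y m w - y m v)

  acute-eventually : LocallyGabriel P G → ¬ ¬ Eventually AcuteAt
  acute-eventually lgg = ¬¬-eventually-∀ λ u → ¬¬-eventually-∀ λ v → ¬¬-eventually-∀ λ w → triple u v w
    where
    triple : ∀ u v w → ¬ ¬ Eventually (λ m → u ~ v → u ~ w → v ≢ w →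
      0ℚ < (x m u - x m v) * (x m w - x m v) + (y m u - y m v) * (y m w - y m v))
    triple u v w ¬ev = cases (u ~? v ×-dec u ~? w ×-dec ¬? (v Fin.≟ w))
      where
      cases : Dec (u ~ v × u ~ w × v ≢ w) → ⊥
      cases (no ¬h) = ¬ev (always λ _ uv uw v≢w → ⊥-elim (¬h (uv , uw , v≢w)))
      -- The disk has diameter `uw` and must avoid `v`. Avoiding it is a doubly negated strict
      -- inequality, which can be opened because the goal is `⊥`.
      cases (yes (uv , uw , v≢w)) = lgg u w uw v (λ v≡u → irrefl (sym v≡u) uv) v≢w (inj₁ uv) λ (ε , 0<ε , closer) →
        ¬ev (eventually-map (λ m h _ _ _ → thales (P u) (P w) (P v) m
          (<-trans (p<p+pos (seq (dist² (P u) (midpoint (P u) (P w))) m) 0<ε) h)) closer)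

  edgeCount-bound-at : ∀ δ m → (∀ p → Rotated.OnHull δ (x m) (y m) p) → AcuteAt m →
    ∀ k → n ℕ.≤ 2 ℕ.^ k → edgeCount ℕ.≤ 2 ℕ.* n ℕ.* k
  edgeCount-bound-at δ m hull acute = EdgeBound.edgeCount-bound X Y (λ p → proj₁ (proj₂ (line p))) (λ p → proj₁ (line p)) G
    (λ p → proj₂ (proj₂ (line p)))
    (λ u v w uv uw v≢w → rotated-dot v u w (acute u v w uv uw v≢w))
    where
    open Rotated δ (x m) (y m)
    line = λ p → supporting-line p (hull p)

  log-bound : Distinct P → ConvexlyIndependent P → LocallyGabriel P G →
    ∀ k → n ℕ.≤ 2 ℕ.^ k → edgeCount ℕ.≤ 2 ℕ.* n ℕ.* k
  log-bound distinct ci lgg k n≤2^k = decidable-stable (edgeCount ℕ.≤? 2 ℕ.* n ℕ.* k) λ ¬bound →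
    ¬¬-eventually-∀ (λ p → ¬¬-eventually-∀ λ j → generic p j) λ ev →
      -- The direction is fixed before the index `m`, since how late the approximation must be taken
      -- depends on it.
      let (q , apart) = eventually⇒∃ ev in
      ¬¬-eventually-∀ (ConvexPosition.onHull P ci q apart) λ hull →
      acute-eventually lgg λ acute →
      let (m , hullₘ , acuteₘ) = eventually⇒∃ (eventually-zip (λ _ → _,_) hull acute) in
      ¬bound (edgeCount-bound-at (frac 1 q) m hullₘ acuteₘ k n≤2^k)
    where
    generic : ∀ p j → ¬ ¬ Eventually (λ q → j ≢ p → Apart (ConvexPosition.u P ci q p j))
    generic p j ¬ev = cases (j Fin.≟ p)
      where
      cases : Dec (j ≡ p) → ⊥
      cases (yes j≡p) = ¬ev (always λ _ j≢p → ⊥-elim (j≢p j≡p))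
      cases (no j≢p)  = tilt-apart (proj₂ (P j) -ℝ proj₂ (P p)) (proj₁ (P j) -ℝ proj₁ (P p))
        (λ (null-y , null-x) → j≢p (distinct (null-x , null-y)))
        λ ev → ¬ev (eventually-map (λ _ a _ → a) ev)

-- From the integer bound to the real logarithm.

ι : ℕ → ℚ
ι a = frac a 0

ι-mono : ∀ {a b} → a ℕ.≤ b → ι a ≤ ι b
ι-mono {a} {b} a≤b = toℚᵘ-cancel-≤
  (ℚᵘ.≤-respˡ-≃ (ℚᵘ.≃-sym (toℚᵘ-frac a 0)) (ℚᵘ.≤-respʳ-≃ (ℚᵘ.≃-sym (toℚᵘ-frac b 0))
    (ℚᵘ.*≤* (subst₂ ℤ._≤_ (sym (ℤ.*-identityʳ (ℤ.+ a))) (sym (ℤ.*-identityʳ (ℤ.+ b))) (ℤ.+≤+ a≤b)))))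

ι-* : ∀ a b → ι (a ℕ.* b) ≡ ι a * ι b
ι-* a b = toℚᵘ-injective (ℚᵘ.≃-trans (toℚᵘ-frac (a ℕ.* b) 0) (ℚᵘ.≃-sym
  (ℚᵘ.≃-trans (toℚᵘ-homo-* (ι a) (ι b)) (ℚᵘ.≃-trans (ℚᵘ.*-cong (toℚᵘ-frac a 0) (toℚᵘ-frac b 0))
    (ℚᵘ.*≡* (cong (ℤ._* ℤ.1ℤ) (sym (ℤ.pos-* a b))))))))

-- Raising `2 ^ L ≤ suc n` to the power `suc m` and taking integer logarithms gives the bound for
-- each term of the sequence, not only in the limit.
⌊log₂n⌋≤log₂n : ∀ n m → ι ⌊log₂ (suc n) ⌋ ≤ log₂-seq (suc n) m
⌊log₂n⌋≤log₂n n m = ≮⇒≥ λ h → ℕ.<⇒≱ (frac-<⁻ ⌊log₂ (suc n ℕ.^ suc m) ⌋ m L 0 h)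
  (subst₂ ℕ._≤_ (⌊log₂[2^n]⌋≡n (L ℕ.* suc m)) (sym (ℕ.*-identityʳ _))
    (⌊log₂⌋-mono-≤ (subst (ℕ._≤ suc n ℕ.^ suc m) (ℕ.^-*-assoc 2 L (suc m))
      (ℕ.^-monoˡ-≤ (suc m) (2^⌊log₂n⌋≤n (suc n) (s≤s z≤n))))))
  where
  L = ⌊log₂ (suc n) ⌋
  frac-<⁻ : ∀ a p b q → frac a p < frac b q → a ℕ.* suc q ℕ.< b ℕ.* suc p
  frac-<⁻ a p b q h with ℚᵘ.<-respˡ-≃ (toℚᵘ-frac a p) (ℚᵘ.<-respʳ-≃ (toℚᵘ-frac b q) (toℚᵘ-mono-< h))
  ... | ℚᵘ.*<* lt = ℤ.drop‿+<+ (subst₂ ℤ._<_ (sym (ℤ.pos-* a (suc q))) (sym (ℤ.pos-* b (suc p))) lt)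

log-bound⇒≤ℝ : ∀ n E → 2 ℕ.≤ n → E ℕ.≤ 2 ℕ.* n ℕ.* suc ⌊log₂ n ⌋ →
  fromℕ E ≤ℝ fromℕ 2 *ℝ fromℕ n *ℝ log₂ n +ℝ fromℕ 2 *ℝ fromℕ n
log-bound⇒≤ℝ n@(suc n′) E _ E≤ (ε , 0<ε , N , h) = <-irrefl refl (<-≤-trans (h N ℕ.≤-refl) (begin
  ι E                                           ≤⟨ ι-mono E≤ ⟩
  ι (2 ℕ.* n ℕ.* suc L)
    ≡⟨ trans (ι-* (2 ℕ.* n) (suc L)) (cong₂ _*_ (ι-* 2 n) (trans (frac-suc L 0) (+-comm (ι L) 1ℚ))) ⟩
  ι 2 * ι n * (1ℚ + ι L)                        ≡⟨ eq (ι 2 * ι n) (ι L) ⟩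
  ι 2 * ι n * ι L + ι 2 * ι n
    ≤⟨ +-monoˡ-≤ (ι 2 * ι n) (*-monoˡ-≤-nonNeg (ι 2 * ι n) {{2n≥0}} (⌊log₂n⌋≤log₂n n′ N)) ⟩
  ι 2 * ι n * log₂-seq n N + ι 2 * ι n          ≡⟨ sym (+-identityʳ (ι 2 * ι n * log₂-seq n N + ι 2 * ι n)) ⟩
  ι 2 * ι n * log₂-seq n N + ι 2 * ι n + 0ℚ     ≤⟨ +-monoʳ-≤ (ι 2 * ι n * log₂-seq n N + ι 2 * ι n) (<⇒≤ 0<ε) ⟩
  ι 2 * ι n * log₂-seq n N + ι 2 * ι n + ε      ∎))
  where
  open ≤-Reasoning
  L = ⌊log₂ n ⌋
  2n≥0 = nonNegative (nonneg*nonneg (ι-mono {0} {2} z≤n) (ι-mono {0} {n} z≤n))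
  eq : ∀ a l → a * (1ℚ + l) ≡ a * l + a
  eq = solve 2 (λ a l → a :* (con 1ℚ :+ l) := a :* l :+ a) refl

theorem4p4 : Σ ℝ λ C →
    (n : ℕ) → 2 ℕ.≤ n →
    (P : Fin n → Point) → Distinct P → ConvexlyIndependent P →
    (G : Graph n) → LocallyGabriel P G →
    fromℕ (Graph.edgeCount G) ≤ℝ fromℕ 2 *ℝ fromℕ n *ℝ log₂ n +ℝ C *ℝ fromℕ n
-- The constant `2` pays for rounding the logarithm up to `suc ⌊log₂ n ⌋`: the extra unit costs
-- `2 n` edges.
theorem4p4 = fromℕ 2 , λ n 2≤n P distinct ci G lgg → log-bound⇒≤ℝ n (Graph.edgeCount G) 2≤n
  (RationalApproximation.log-bound P G distinct ci lgg (suc ⌊log₂ n ⌋) (ℕ.<⇒≤ (n<2^[1+⌊log₂n⌋] n)))
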